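{- Let $X=x_1\cdots x_n$, $Y=y_1\cdots y_m$ and $P=p_1\cdots p_r$ be strings over a finite alphabet $\Sigma$, of lengths $n,m,r\ge 1$ respectively. Algorithm A described in the context solves the STR-EC-LCS problem correctly, i.e. the value it returns is the maximum length of a common subsequence of $X$ and $Y$ that does not contain $P$ as a substring. It uses $O(nmr)$ time and $O(nmr)$ space, with preprocessing time $O(r|\Sigma|)$ for computing the table $\lambda$.
   Context: A subsequence of a string is obtained by deleting zero or more (not necessarily contiguous) characters; a substring is a block of consecutive characters. A common subsequence of two strings is a string that is a subsequence of both (the empty string is allowed). The STR-EC-LCS problem: given $X,Y,P$, find a longest common subsequence of $X$ and $Y$ among those not containing $P$ as a substring (its length is what Algorithm A outputs). For a string $S$, $\sigma(S)$ is the length of the longest (possibly empty) suffix of $S$ that is also a prefix of $P$. $P[1:k]=p_1\cdots p_k$ (empty for $k=0$) and $\oplus$ denotes concatenation. Preprocessing: compute the table $\lambda(k,a)=\sigma(P[1:k]\oplus a)$ for all $0\le k<r$ and $a\in\Sigma$; afterwards each entry is available in $O(1)$ time. Algorithm A (maintains an array $f(i,j,k)$, $0\le i\le n$, $0\le j\le m$, $0\le k\le r$): 1. Set $f(i,0,k)\leftarrow 0$ and $f(0,j,k)\leftarrow 0$ for all $0\le i\le n$, $0\le j\le m$, $0\le k\le r$. 2. For $i=1,\dots,n$, and for each $i$ for $j=1,\dots,m$, do: (a) for $k=0,\dots,r$: $f(i,j,k)\leftarrow\max\{f(i-1,j,k),f(i,j-1,k)\}$; (b) if $x_i=y_j$,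 then for $k=0,\dots,r-1$: let $t\leftarrow\lambda(k,x_i)$ and set $f(i,j,t)\leftarrow\max\{f(i,j,t),\,1+f(i-1,j-1,k)\}$. 3. Return $\max_{0\le t<r} f(n,m,t)$. Time and space are measured in the standard unit-cost RAM model (elementary operations on characters, indices and integers cost $O(1)$; table indexing by characters of $\Sigma$ costs $O(1)$). -}

module Defs where

open import Data.Bool using (if_then_else_)
open import Data.Fin using (Fin; toℕ)
open import Data.List using (List; []; _∷_; _++_; length; take; lookup; deduplicate)
open import Data.List.Properties using () renaming (≡-dec to List-≡-dec)
open import Data.List.Relation.Binary.Infix.Heterogeneous using (Infix)
open import Data.List.Relation.Binary.Prefix.Heterogeneous using (Prefix)
open import Data.List.Relation.Binary.Sublist.Propositional using (_⊆_)
open import Data.List.Relation.Binary.Suffix.Heterogeneous using (Suffix)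
open import Data.Nat using (ℕ; zero; suc; _+_; _∸_; _⊔_; _≤_; _<_; _≡ᵇ_)
import Data.Nat as ℕ
open import Data.Product using (_×_; _,_; ∃-syntax)
open import Data.Product.Properties using () renaming (≡-dec to ×-≡-dec)
open import Relation.Binary.Definitions using (DecidableEquality)
open import Relation.Binary.PropositionalEquality using (_≡_)
open import Relation.Nullary using (¬_)
open import Relation.Nullary.Decidable using (does)

module _ {q : ℕ} where

  LongestLength : (List (Fin q) → Set) → ℕ → Set
  LongestLength Q v = (∃[ Z ] (Q Z × length Z ≡ v)) × (∀ Z → Q Z → length Z ≤ v)

  -- P ⊢σ S ≈ l  reads  σ(S) = l  with respect to the pattern P.
  _⊢σ_≈_ : List (Fin q) → List (Fin q) → ℕ → Set
  P ⊢σ S ≈ l = LongestLength (λ U → Suffix _≡_ U S × Prefix _≡_ U P) l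

  Feasible : (X Y P : List (Fin q)) → List (Fin q) → Set
  Feasible X Y P Z = Z ⊆ X × Z ⊆ Y × ¬ Infix _≡_ P Z

  STR-EC-LCS : (X Y P : List (Fin q)) → ℕ → Set
  STR-EC-LCS X Y P = LongestLength (Feasible X Y P)

-- A structured unit-cost random access machine.  Programs are finite syntax,
-- so no computation can escape the cost count.  Memory consists of named
-- arrays of natural numbers; a scalar variable is an array with the empty
-- index.  The number of indices in an access is fixed by the program text,
-- hence every access is an elementary operation.

Name : Set
Name = ℕ

Cell : Set
Cell = Name × List ℕ

_≟ᶜ_ : DecidableEquality Cell
_≟ᶜ_ = ×-≡-dec ℕ._≟_ (List-≡-dec ℕ._≟_)

Store : Set
Store = Cell → ℕ

_[_↦_] : Store → Cell → ℕ → Store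
(s [ c ↦ v ]) c′ = if does (c ≟ᶜ c′) then v else s c′

infix  9 _[_]
infixl 7 _⊔ᵉ_
infixl 6 _+ᵉ_ _∸ᵉ_
infix  5 _==_
infix  4 _[_]:=_
infixr 3 for_from_to_perform_ when_perform_
infixr 2 _⨾_

data Expr : Set where
  #_             : ℕ → Expr
  _[_]           : Name → List Expr → Expr
  _+ᵉ_ _∸ᵉ_ _⊔ᵉ_ : Expr → Expr → Expr

data Test : Set where
  _==_ : Expr → Expr → Test

-- for x from a to b perform c  runs c with x = a, a + 1, …, b (inclusive);
-- the bounds are evaluated once, on entry.
data Cmd : Set where
  _[_]:=_               : Name → List Expr → Expr → Cmd
  _⨾_                   : Cmd → Cmd → Cmd
  when_perform_         : Test → Cmd → Cmd
  for_from_to_perform_  : Name → Expr → Expr → Cmd → Cmd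

mutual
  eval : Store → Expr → ℕ
  eval s (# v)      = v
  eval s (x [ es ]) = s (x , evals s es)
  eval s (a +ᵉ b)   = eval s a + eval s b
  eval s (a ∸ᵉ b)   = eval s a ∸ eval s b
  eval s (a ⊔ᵉ b)   = eval s a ⊔ eval s b

  evals : Store → List Expr → List ℕ
  evals s []       = []
  evals s (e ∷ es) = eval s e ∷ evals s es

mutual
  cost : Expr → ℕ
  cost (# v)      = 1
  cost (x [ es ]) = 1 + costs es
  cost (a +ᵉ b)   = 1 + cost a + cost b
  cost (a ∸ᵉ b)   = 1 + cost a + cost b
  cost (a ⊔ᵉ b)   = 1 + cost a + cost b

  costs : List Expr → ℕ
  costs []       = 0
  costs (e ∷ es) = cost e + costs es

mutual
  reads : Store → Expr → List Cell
  reads s (# v)      = []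
  reads s (x [ es ]) = (x , evals s es) ∷ readss s es
  reads s (a +ᵉ b)   = reads s a ++ reads s b
  reads s (a ∸ᵉ b)   = reads s a ++ reads s b
  reads s (a ⊔ᵉ b)   = reads s a ++ reads s b

  readss : Store → List Expr → List Cell
  readss s []       = []
  readss s (e ∷ es) = reads s e ++ readss s es

-- touched lists every cell read or written, in order and with repetitions.
record Run : Set where
  constructor mkRun
  field
    final   : Store
    time    : ℕ
    touched : List Cell

  space : ℕ
  space = length (deduplicate _≟ᶜ_ touched)

open Run public

charge : ℕ → List Cell → Run → Run
charge t cs ρ = mkRun (final ρ) (t + time ρ) (cs ++ touched ρ)

andThen : Run → (Store → Run) → Run
andThen ρ f = charge (time ρ) (touched ρ) (f (final ρ))

-- loop x body v k s  runs body for x = v, …, v + k - 1.  Each round costs 2 on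
-- top of its body (test and update of x); the failing test at the end costs 1.
loop : Name → (Store → Run) → ℕ → ℕ → Store → Run
loop x body v zero    s = mkRun s 1 []
loop x body v (suc k) s =
  charge 2 ((x , []) ∷ [])
    (andThen (body (s [ x , [] ↦ v ])) (loop x body (suc v) k))

exec : Cmd → Store → Run
exec (x [ es ]:= e) s =
  mkRun (s [ x , evals s es ↦ eval s e ])
        (1 + costs es + cost e)
        (readss s es ++ reads s e ++ (x , evals s es) ∷ [])
exec (c ⨾ d) s = andThen (exec c s) (exec d)
exec (when a == b perform c) s =
  charge (1 + cost a + cost b) (reads s a ++ reads s b)
    (if eval s a ≡ᵇ eval s b then exec c s else mkRun s 0 [])
exec (for x from a to b perform c) s =
  charge (1 + cost a + cost b) (reads s a ++ reads s b)
    (loop x (exec c) (eval s a) (suc (eval s b) ∸ eval s a) s)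

-- Names from 14 on are free for use as scratch memory.

nᵛ mᵛ rᵛ qᵛ iᵛ jᵛ kᵛ tᵛ outᵛ : Name
nᵛ = 0 ; mᵛ = 1 ; rᵛ = 2 ; qᵛ = 3
iᵛ = 4 ; jᵛ = 5 ; kᵛ = 6 ; tᵛ = 7 ; outᵛ = 8

xᵃ yᵃ pᵃ λᵃ fᵃ : Name
xᵃ = 9 ; yᵃ = 10 ; pᵃ = 11 ; λᵃ = 12 ; fᵃ = 13

-- The string occupies positions 1, …, length S of the array; characters are
-- stored as their codes 0, …, q - 1.
record HoldsString {q : ℕ} (array len : Name) (S : List (Fin q)) (s : Store) : Set where
  field
    len-cell   : s (len , []) ≡ length S
    char-cells : ∀ (i : Fin (length S)) → s (array , suc (toℕ i) ∷ []) ≡ toℕ (lookup S i)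

record HoldsPattern {q : ℕ} (P : List (Fin q)) (s : Store) : Set where
  field
    alphabet-size : s (qᵛ , []) ≡ q
    pattern-cells : HoldsString pᵃ rᵛ P s

record HoldsTexts {q : ℕ} (X Y : List (Fin q)) (s : Store) : Set where
  field
    X-cells : HoldsString xᵃ nᵛ X s
    Y-cells : HoldsString yᵃ mᵛ Y s

HoldsTable : {q : ℕ} → List (Fin q) → Store → Set
HoldsTable {q} P s =
  ∀ k → k < length P → ∀ (a : Fin q) →
  P ⊢σ (take k P ++ a ∷ []) ≈ s (λᵃ , k ∷ toℕ a ∷ [])

n m r i j k t : Expr
n = nᵛ [ [] ]
m = mᵛ [ [] ]
r = rᵛ [ [] ]
i = iᵛ [ [] ]
j = jᵛ [ [] ]
k = kᵛ [ [] ]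
t = tᵛ [ [] ]

f : Expr → Expr → Expr → Expr
f a b c = fᵃ [ a ∷ b ∷ c ∷ [] ]

infix 4 f⟨_,_,_⟩:=_
f⟨_,_,_⟩:=_ : Expr → Expr → Expr → Expr → Cmd
f⟨ a , b , c ⟩:= e = fᵃ [ a ∷ b ∷ c ∷ [] ]:= e

initialise : Cmd
initialise =
  (for iᵛ from # 0 to n perform
   for kᵛ from # 0 to r perform
     f⟨ i , # 0 , k ⟩:= # 0) ⨾
  (for jᵛ from # 0 to m perform
   for kᵛ from # 0 to r perform
     f⟨ # 0 , j , k ⟩:= # 0)

stepA : Cmd
stepA =
  for kᵛ from # 0 to r perform
    f⟨ i , j , k ⟩:= f (i ∸ᵉ # 1) j k ⊔ᵉ f i (j ∸ᵉ # 1) k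

stepB : Cmd
stepB =
  when xᵃ [ i ∷ [] ] == yᵃ [ j ∷ [] ] perform
  for kᵛ from # 0 to r ∸ᵉ # 1 perform
    (tᵛ [ [] ]:= λᵃ [ k ∷ xᵃ [ i ∷ [] ] ∷ [] ] ⨾
     f⟨ i , j , t ⟩:= f i j t ⊔ᵉ (# 1 +ᵉ f (i ∸ᵉ # 1) (j ∸ᵉ # 1) k))

mainLoop : Cmd
mainLoop =
  for iᵛ from # 1 to n perform
  for jᵛ from # 1 to m perform
    (stepA ⨾ stepB)

-- Values are natural numbers, so 0 is neutral for the maximum.
result : Cmd
result =
  outᵛ [ [] ]:= # 0 ⨾
  for tᵛ from # 0 to r ∸ᵉ # 1 perform
    outᵛ [ [] ]:= outᵛ [ [] ] ⊔ᵉ f n m t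

algorithmA : Cmd
algorithmA = initialise ⨾ mainLoop ⨾ result

output : Run → ℕ
output ρ = final ρ (outᵛ , [])

{-# OPTIONS --safe #-}
module Submission where

-- Correctness.  σ(S ⊕ a) depends on S only through σ(S), so the table λ is the transition
-- function of an automaton that tracks σ while a string is read; P occurs in the string
-- exactly when the automaton reaches the state r.  The entry f(i,j,k) is attained by a common
-- subsequence of X[1:i] and Y[1:j] that takes the automaton from some state to k while
-- staying below r, and dominates all those that start in state 0: for a common subsequence,
-- x_i is unused, or y_j is unused, or both are matched to its last character, which then
-- contributes through the transition out of the previous state.
--
-- Preprocessing.  Let b be the longest proper border of P[1:k].  Row k of λ agrees with row b,
-- except that λ(k, p_{k+1}) = k + 1, and the entry overwritten there is the next border.
--
-- Cost.  Loop bounds only read variables that are never written, so the running time is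
-- bounded by an expression in the input lengths; each touched cell is paid for by one
-- unit of time.

open import Defs using (Cmd; Store; Run; exec; time; space; final; output; algorithmA; STR-EC-LCS; HoldsTexts; HoldsPattern; HoldsTable)
open import Data.Fin using (Fin)
open import Data.List using (List; length)
open import Data.Nat using (ℕ; _*_; _≤_)
open import Data.Product using (_×_; ∃-syntax)

open import Defs
open import Data.Bool using (Bool; true; false; T; not; _∧_; _∨_)
open import Data.Bool.Properties using (∧-conicalˡ; ∧-conicalʳ; not-injective)
open import Data.Fin using (zero; suc; toℕ; fromℕ<)
open import Data.Fin.Properties using (toℕ-fromℕ<; toℕ-injective; toℕ<n)
open import Data.List using ([]; _∷_; _++_; _∷ʳ_; take; drop; lookup; deduplicate; initLast; _∷ʳ′_)
open import Data.List.Properties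
  using (∷ʳ-injective; ++-assoc; length-++; length-filter; length-take; length-drop; take-suc; take-all)
open import Data.List.Relation.Binary.Infix.Heterogeneous using (Infix; here; there; _ⁱ++_)
import Data.List.Relation.Binary.Infix.Heterogeneous.Properties as Infixₚ
open import Data.List.Relation.Binary.Pointwise using (Pointwise-≡⇒≡; ≡⇒Pointwise-≡)
open import Data.List.Relation.Binary.Prefix.Heterogeneous using (Prefix; []; _∷_; _++ᵖ_)
import Data.List.Relation.Binary.Prefix.Heterogeneous.Properties as Prefixₚ
open import Data.List.Relation.Binary.Sublist.Propositional
  using (_⊆_; []; _∷_; minimum; ⊆-refl; ⊆-trans) renaming (_∷ʳ_ to omit)
open import Data.List.Relation.Binary.Sublist.Propositional.Properties using (++⁺; ++⁺ʳ; length-mono-≤)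
open import Data.List.Relation.Binary.Suffix.Heterogeneous as Suffix using (Suffix; here; there; _++ˢ_)
import Data.List.Relation.Binary.Suffix.Heterogeneous.Properties as Suffixₚ
open import Data.List.Reverse using (Reverse; []; _∶_∶ʳ_; reverseView)
open import Data.Nat using (zero; suc; _+_; _∸_; _⊔_; _<_; _≡ᵇ_; z≤n; s≤s)
open import Data.Nat.Properties hiding (_≟_)
open import Data.Nat.Tactic.RingSolver using (solve-∀)
open import Data.Product using (_,_; proj₁; proj₂)
open import Data.Sum using (_⊎_; inj₁; inj₂)
open import Function using (_∘_; id)
open import Relation.Binary.Definitions using (DecidableEquality)
open import Relation.Binary.PropositionalEquality hiding ([_])
open import Relation.Nullary using (¬_; ¬?; yes; no; contradiction)

open HoldsString
open HoldsTexts
open HoldsPattern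

-- Hoare logic and cost of the machine

update-same : ∀ s c {v} → (s [ c ↦ v ]) c ≡ v
update-same s c with c ≟ᶜ c
... | yes _  = refl
... | no c≢c = contradiction refl c≢c

update-other : ∀ s {c c′ v} → c ≢ c′ → (s [ c ↦ v ]) c′ ≡ s c′
update-other s {c} {c′} c≢c′ with c ≟ᶜ c′
... | yes c≡c′ = contradiction c≡c′ c≢c′
... | no _     = refl

update-elim : ∀ (Q : ℕ → Set) s c c′ {v} → (c ≡ c′ → Q v) → (c ≢ c′ → Q (s c′)) → Q ((s [ c ↦ v ]) c′)
update-elim Q s c c′ hit miss with c ≟ᶜ c′
... | yes c≡c′ = hit c≡c′
... | no c≢c′  = miss c≢c′

-- As a record, a triple lets unification recover its assertions and its command. Since `exec` is
-- total, this is total correctness.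
record ⟨_⟩_⟨_⟩ (A : Store → Set) (c : Cmd) (B : Store → Set) : Set where
  constructor triple
  field
    run : ∀ {s} → A s → B (final (exec c s))

open ⟨_⟩_⟨_⟩

consequence : ∀ {A A′ B B′ c} → (∀ {s} → A s → A′ s) → (∀ {s} → B′ s → B s) →
              ⟨ A′ ⟩ c ⟨ B′ ⟩ → ⟨ A ⟩ c ⟨ B ⟩
consequence pre post h .run = post ∘ h .run ∘ pre

assign-rule : ∀ {A B x es e} →
              (∀ {s} → A s → ∃[ is ] ∃[ v ] (evals s es ≡ is × eval s e ≡ v × B (s [ x , is ↦ v ]))) →
              ⟨ A ⟩ x [ es ]:= e ⟨ B ⟩
assign-rule h .run a with _ , _ , refl , refl , b ← h a = b

infixr 2 _⨟_
_⨟_ : ∀ {A B C c d} → ⟨ A ⟩ c ⟨ B ⟩ → ⟨ B ⟩ d ⟨ C ⟩ → ⟨ A ⟩ c ⨾ d ⟨ C ⟩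
(g ⨟ h) .run = h .run ∘ g .run

when-rule : ∀ {A B a b c} →
            ⟨ (λ s → A s × eval s a ≡ eval s b) ⟩ c ⟨ B ⟩ →
            (∀ {s} → A s → eval s a ≢ eval s b → B s) →
            ⟨ A ⟩ when a == b perform c ⟨ B ⟩
when-rule {a = a} {b} h skip .run {s} As with eval s a ≡ᵇ eval s b in eq
... | true  = h .run (As , ≡ᵇ⇒≡ _ _ (subst T (sym eq) _))
... | false = skip As λ a≡b → subst T eq (≡⇒≡ᵇ _ _ a≡b)

-- `I v` describes the store before the round with index `v`, so the exit assertion is `I (suc hi)`;
-- `lo ≤ suc hi` makes this right for an empty loop too. The bound is evaluated once, on entry,
-- hence only under `I lo`. The third hypothesis covers the machine's own update of the loop
-- variable.
for-rule : ∀ (I : ℕ → Store → Set) {lo hi x b c} → lo ≤ suc hi →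
           (∀ {s} → I lo s → eval s b ≡ hi) →
           (∀ {v s} → I v s → I v (s [ (x , []) ↦ v ])) →
           (∀ v → lo ≤ v → v ≤ hi → ⟨ (λ s → I v s × s (x , []) ≡ v) ⟩ c ⟨ I (suc v) ⟩) →
           ⟨ I lo ⟩ for x from # lo to b perform c ⟨ I (suc hi) ⟩
for-rule I {lo} {hi} {x} {b} {c} lo≤ bound≡ fresh body .run {s} start
  rewrite bound≡ start =
    subst (λ v → I v (final (loop x (exec c) lo (suc hi ∸ lo) s))) (m+[n∸m]≡n lo≤)
      (go lo (suc hi ∸ lo) ≤-refl (≤-reflexive (m+[n∸m]≡n lo≤)) start)
  where
  go : ∀ v k {s} → lo ≤ v → v + k ≤ suc hi → I v s → I (v + k) (final (loop x (exec c) v k s))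
  go v zero    _    _   Iv = subst (λ v → I v _) (sym (+-identityʳ v)) Iv
  go v (suc k) {s} lo≤v v+k≤ Iv rewrite +-suc v k =
    go (suc v) k (m≤n⇒m≤1+n lo≤v) v+k≤
      (body v lo≤v (≤-pred (≤-trans (s≤s (m≤m+n v k)) v+k≤)) .run (fresh Iv , update-same s (x , [])))

-- Frame property and running time

writes : Cmd → Name → Bool
writes (x [ _ ]:= _)                 y = x ≡ᵇ y
writes (c ⨾ d)                       y = writes c y ∨ writes d y
writes (when _ perform c)            y = writes c y
writes (for x from _ to _ perform c) y = (x ≡ᵇ y) ∨ writes c y

-- All loop bounds are evaluated in the given store, and every test is assumed to succeed.
bound : Store → Cmd → ℕ
bound s (x [ es ]:= e)                = 1 + costs es + cost e
bound s (c ⨾ d)                       = bound s c + bound s d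
bound s (when a == b perform c)       = 1 + cost a + cost b + bound s c
bound s (for x from a to b perform c) =
  1 + cost a + cost b + (1 + (suc (eval s b) ∸ eval s a) * (2 + bound s c))

-- w is the set of names that may be written.
module Frame (w : Name → Bool) where

  mutual
    avoids : Expr → Bool
    avoids (# _)      = true
    avoids (x [ es ]) = not (w x) ∧ avoidss es
    avoids (a +ᵉ b)   = avoids a ∧ avoids b
    avoids (a ∸ᵉ b)   = avoids a ∧ avoids b
    avoids (a ⊔ᵉ b)   = avoids a ∧ avoids b

    avoidss : List Expr → Bool
    avoidss []       = true
    avoidss (e ∷ es) = avoids e ∧ avoidss es

  -- Loop bounds must not read written names; then throughout the run they evaluate as in the
  -- initial store, which is where `bound` evaluates them. For the two programs below, with `w`
  -- their own `writes`, the condition computes to `true`.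
  steady : Cmd → Bool
  steady (x [ _ ]:= _)                 = w x
  steady (c ⨾ d)                       = steady c ∧ steady d
  steady (when _ perform c)            = steady c
  steady (for x from a to b perform c) = w x ∧ (avoids a ∧ avoids b) ∧ steady c

  record _≈_ (s s′ : Store) : Set where
    constructor agree
    field
      unchanged : ∀ y is → w y ≡ false → s′ (y , is) ≡ s (y , is)

  open _≈_ public

  ≈-refl : ∀ {s} → s ≈ s
  ≈-refl = agree λ _ _ _ → refl

  ≈-update : ∀ x is {s s′ v} → w x ≡ true → s ≈ s′ → s ≈ (s′ [ x , is ↦ v ])
  ≈-update x is {s′ = s′} wx s≈s′ .unchanged y js wy =
    trans (update-other s′ {x , is} {y , js} λ {refl → contradiction (trans (sym wx) wy) λ ()})
      (s≈s′ .unchanged y js wy)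

  module _ {s s′ : Store} (s≈s′ : s ≈ s′) where mutual

    eval-≈ : ∀ e → avoids e ≡ true → eval s′ e ≡ eval s e
    eval-≈ (# _)      _ = refl
    eval-≈ (x [ es ]) h
      rewrite evals-≈ es (∧-conicalʳ _ _ h) = s≈s′ .unchanged x _ (not-injective (∧-conicalˡ _ _ h))
    eval-≈ (a +ᵉ b)   h = cong₂ _+_ (eval-≈ a (∧-conicalˡ _ _ h)) (eval-≈ b (∧-conicalʳ _ _ h))
    eval-≈ (a ∸ᵉ b)   h = cong₂ _∸_ (eval-≈ a (∧-conicalˡ _ _ h)) (eval-≈ b (∧-conicalʳ _ _ h))
    eval-≈ (a ⊔ᵉ b)   h = cong₂ _⊔_ (eval-≈ a (∧-conicalˡ _ _ h)) (eval-≈ b (∧-conicalʳ _ _ h))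

    evals-≈ : ∀ es → avoidss es ≡ true → evals s′ es ≡ evals s es
    evals-≈ []       _ = refl
    evals-≈ (e ∷ es) h = cong₂ _∷_ (eval-≈ e (∧-conicalˡ _ _ h)) (evals-≈ es (∧-conicalʳ _ _ h))

  module _ {s : Store} where

    loop-≈ : ∀ {x c T} → w x ≡ true →
             (∀ {s′} → s ≈ s′ → s ≈ final (exec c s′) × time (exec c s′) ≤ T) →
             ∀ v k {s′} → s ≈ s′ →
             s ≈ final (loop x (exec c) v k s′) × time (loop x (exec c) v k s′) ≤ 1 + k * (2 + T)
    loop-≈ wx body v zero s≈s′ = s≈s′ , ≤-refl
    loop-≈ {x} {c} {T} wx body v (suc k) s≈s′ = proj₁ rest , bound≤
      where
      first = body (≈-update x [] wx s≈s′)
      rest  = loop-≈ wx body (suc v) k (proj₁ first)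
      bound≤ : _ ≤ 1 + (2 + T + k * (2 + T))
      -- The 1 for the failing test at the end, counted in `rest`, moves to the front.
      bound≤ = ≤-trans (+-monoʳ-≤ 2 (+-mono-≤ (proj₂ first) (proj₂ rest)))
                 (≤-reflexive (cong (2 +_) (+-suc T _)))

    -- Agreement and time are proved together and for every `s′` agreeing with `s`: a later command
    -- starts from a changed store, and its loop bounds are known only because that store still
    -- agrees with `s`.
    exec-≈ : ∀ c → steady c ≡ true → ∀ {s′} → s ≈ s′ →
             s ≈ final (exec c s′) × time (exec c s′) ≤ bound s c
    exec-≈ (x [ es ]:= e) h s≈s′ = ≈-update x _ h s≈s′ , ≤-refl
    exec-≈ (c ⨾ d) h s≈s′ =
      let s≈s₁ , t₁ = exec-≈ c (∧-conicalˡ _ _ h) s≈s′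
          s≈s₂ , t₂ = exec-≈ d (∧-conicalʳ _ _ h) s≈s₁
      in  s≈s₂ , +-mono-≤ t₁ t₂
    exec-≈ (when a == b perform c) h {s′} s≈s′ with eval s′ a ≡ᵇ eval s′ b
    ... | true  = let s≈s₁ , t₁ = exec-≈ c h s≈s′ in s≈s₁ , +-monoʳ-≤ (1 + cost a + cost b) t₁
    ... | false = s≈s′ , +-monoʳ-≤ (1 + cost a + cost b) z≤n
    exec-≈ (for x from a to b perform c) h {s′} s≈s′
      rewrite eval-≈ s≈s′ a (∧-conicalˡ _ _ (∧-conicalˡ _ _ (∧-conicalʳ (w x) _ h)))
            | eval-≈ s≈s′ b (∧-conicalʳ (avoids a) _ (∧-conicalˡ _ _ (∧-conicalʳ (w x) _ h))) =
      let s≈s₁ , t₁ = loop-≈ (∧-conicalˡ _ _ h)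
                        (exec-≈ c (∧-conicalʳ (avoids a ∧ avoids b) _ (∧-conicalʳ (w x) _ h)))
                        (eval s a) (suc (eval s b) ∸ eval s a) s≈s′
      in  s≈s₁ , +-monoʳ-≤ (1 + cost a + cost b) t₁

  exec-frame : ∀ c → steady c ≡ true → ∀ s → s ≈ final (exec c s)
  exec-frame c h s = proj₁ (exec-≈ c h ≈-refl)

  exec-time : ∀ c → steady c ≡ true → ∀ s → time (exec c s) ≤ bound s c
  exec-time c h s = proj₂ (exec-≈ c h ≈-refl)

-- Space is bounded by time

length-++-≤ : ∀ {A : Set} {m n} (xs {ys} : List A) → length xs ≤ m → length ys ≤ n → length (xs ++ ys) ≤ m + n
length-++-≤ xs l₁ l₂ = ≤-trans (≤-reflexive (length-++ xs)) (+-mono-≤ l₁ l₂)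

mutual
  reads≤cost : ∀ s e → length (reads s e) ≤ cost e
  reads≤cost s (# _)      = z≤n
  reads≤cost s (x [ es ]) = s≤s (readss≤costs s es)
  reads≤cost s (a +ᵉ b)   = m≤n⇒m≤1+n (length-++-≤ (reads s a) (reads≤cost s a) (reads≤cost s b))
  reads≤cost s (a ∸ᵉ b)   = m≤n⇒m≤1+n (length-++-≤ (reads s a) (reads≤cost s a) (reads≤cost s b))
  reads≤cost s (a ⊔ᵉ b)   = m≤n⇒m≤1+n (length-++-≤ (reads s a) (reads≤cost s a) (reads≤cost s b))

  readss≤costs : ∀ s es → length (readss s es) ≤ costs es
  readss≤costs s []       = z≤n
  readss≤costs s (e ∷ es) = length-++-≤ (reads s e) (reads≤cost s e) (readss≤costs s es)

test-reads≤cost : ∀ s a b → length (reads s a ++ reads s b) ≤ 1 + cost a + cost b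
test-reads≤cost s a b = m≤n⇒m≤1+n (length-++-≤ (reads s a) (reads≤cost s a) (reads≤cost s b))

loop-touched≤time : ∀ x {c} → (∀ s → length (touched (exec c s)) ≤ time (exec c s)) →
                    ∀ v k s → length (touched (loop x (exec c) v k s)) ≤ time (loop x (exec c) v k s)
loop-touched≤time x body v zero    s = z≤n
loop-touched≤time x {c} body v (suc k) s =
  s≤s (m≤n⇒m≤1+n (length-++-≤ (touched (exec c _)) (body _) (loop-touched≤time x body (suc v) k _)))

touched≤time : ∀ c s → length (touched (exec c s)) ≤ time (exec c s)
touched≤time (x [ es ]:= e) s =
  ≤-trans (length-++-≤ (readss s es) (readss≤costs s es) (length-++-≤ (reads s e) (reads≤cost s e) ≤-refl))
    (≤-reflexive (trans (sym (+-assoc (costs es) (cost e) 1)) (+-comm _ 1)))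
touched≤time (c ⨾ d) s = length-++-≤ (touched (exec c s)) (touched≤time c s) (touched≤time d _)
touched≤time (when a == b perform c) s with eval s a ≡ᵇ eval s b
... | true  = length-++-≤ (reads s a ++ reads s b) (test-reads≤cost s a b) (touched≤time c s)
... | false = length-++-≤ (reads s a ++ reads s b) (test-reads≤cost s a b) z≤n
touched≤time (for x from a to b perform c) s =
  length-++-≤ (reads s a ++ reads s b) (test-reads≤cost s a b)
    (loop-touched≤time x {c} (touched≤time c) (eval s a) (suc (eval s b) ∸ eval s a) s)

length-deduplicate-≤ : ∀ {A : Set} (_≟_ : DecidableEquality A) xs → length (deduplicate _≟_ xs) ≤ length xs
length-deduplicate-≤ _≟_ []       = z≤n
length-deduplicate-≤ _≟_ (x ∷ xs) =
  s≤s (≤-trans (length-filter (¬? ∘ (x ≟_)) (deduplicate _≟_ xs)) (length-deduplicate-≤ _≟_ xs))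

space≤time : ∀ c s → space (exec c s) ≤ time (exec c s)
space≤time c s = ≤-trans (length-deduplicate-≤ _≟ᶜ_ (touched (exec c s))) (touched≤time c s)

-- Strings and σ

module _ {A : Set} where

  length-∷ʳ : ∀ (xs : List A) {a} → length (xs ∷ʳ a) ≡ suc (length xs)
  length-∷ʳ xs = trans (length-++ xs) (+-comm _ 1)

  length-take-≤ : ∀ k (xs : List A) → k ≤ length xs → length (take k xs) ≡ k
  length-take-≤ k xs k≤ = trans (length-take k xs) (m≤n⇒m⊓n≡m k≤)

  suffix-refl : ∀ {U : List A} → Suffix _≡_ U U
  suffix-refl = here (≡⇒Pointwise-≡ refl)

  suffix-[] : ∀ (S : List A) → Suffix _≡_ [] S
  suffix-[] []      = suffix-refl
  suffix-[] (_ ∷ S) = there (suffix-[] S)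

  suffix-trans : ∀ {U V S : List A} → Suffix _≡_ U V → Suffix _≡_ V S → Suffix _≡_ U S
  suffix-trans = Suffixₚ.trans trans

  suffix-∷ʳ⁺ : ∀ {U S : List A} {a} → Suffix _≡_ U S → Suffix _≡_ (U ∷ʳ a) (S ∷ʳ a)
  suffix-∷ʳ⁺ p = Suffixₚ.++⁺ p (≡⇒Pointwise-≡ refl)

  suffix-∷ʳ⁻ : ∀ {U S : List A} {a} → Suffix _≡_ U (S ∷ʳ a) →
               U ≡ [] ⊎ ∃[ U′ ] (U ≡ U′ ∷ʳ a × Suffix _≡_ U′ S)
  suffix-∷ʳ⁻ {U} {S} {a} p = split (Suffix.toView p) refl
    where
    split : ∀ {T} → Suffix.SuffixView _≡_ U T → T ≡ S ∷ʳ a →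
            U ≡ [] ⊎ ∃[ U′ ] (U ≡ U′ ∷ʳ a × Suffix _≡_ U′ S)
    split (cs Suffix.++ pw) eq with refl ← Pointwise-≡⇒≡ pw with initLast U
    ... | []       = inj₁ refl
    ... | U′ ∷ʳ′ u with refl , refl ← ∷ʳ-injective (cs ++ U′) S (trans (++-assoc cs U′ _) eq) =
      inj₂ (U′ , refl , cs ++ˢ suffix-refl)

  suffix-linear : ∀ {U V S : List A} → Suffix _≡_ U S → Suffix _≡_ V S →
                  length U ≤ length V → Suffix _≡_ U V
  suffix-linear p (here pw) _ with refl ← Pointwise-≡⇒≡ pw = p
  suffix-linear (there p) (there q) l = suffix-linear p q l
  -- Here `U` is the whole string and `V` a proper suffix of it, so `U` would be the longer one.
  suffix-linear (here pw) (there q) l with refl ← Pointwise-≡⇒≡ pw =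
    contradiction (≤-trans l (Suffixₚ.length-mono q)) (<-irrefl refl)

  prefix-≡-take : ∀ {U P : List A} → Prefix _≡_ U P → U ≡ take (length U) P
  prefix-≡-take []         = refl
  prefix-≡-take (refl ∷ p) = cong (_ ∷_) (prefix-≡-take p)

  take-prefix : ∀ k (P : List A) → Prefix _≡_ (take k P) P
  take-prefix zero    P       = []
  take-prefix (suc k) []      = []
  take-prefix (suc k) (_ ∷ P) = refl ∷ take-prefix k P

  prefix-∷ʳ⁻ : ∀ {U P : List A} {a} → Prefix _≡_ (U ∷ʳ a) P → Prefix _≡_ U P
  prefix-∷ʳ⁻ {U} = Prefixₚ.trans trans (Prefixₚ.fromPointwise (≡⇒Pointwise-≡ refl) ++ᵖ _)

  -- A new letter can only create an occurrence that ends in it. This is why watching suffixes, as σ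
  -- does, is enough to detect `P`.
  infix-∷ʳ⁻ : ∀ {P S : List A} {a} → Infix _≡_ P (S ∷ʳ a) → Infix _≡_ P S ⊎ Suffix _≡_ P (S ∷ʳ a)
  infix-∷ʳ⁻ {S = []} (here [])          = inj₁ (here [])
  infix-∷ʳ⁻ {S = []} (here (refl ∷ [])) = inj₂ suffix-refl
  infix-∷ʳ⁻ {S = []} (there (here []))  = inj₁ (here [])
  infix-∷ʳ⁻ {P} {x ∷ S} {a} (here p)  = split (initial p)
    where
    initial : ∀ {U T : List A} {a} → Prefix _≡_ U (T ∷ʳ a) → Prefix _≡_ U T ⊎ U ≡ T ∷ʳ a
    initial {T = []}     []                = inj₁ []
    initial {T = []}     (refl ∷ [])       = inj₂ refl
    initial {T = _ ∷ _}  []                = inj₁ []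
    initial {T = _ ∷ _}  (refl ∷ p) with initial p
    ... | inj₁ q    = inj₁ (refl ∷ q)
    ... | inj₂ refl = inj₂ refl
    split : Prefix _≡_ P (x ∷ S) ⊎ P ≡ x ∷ S ∷ʳ a → Infix _≡_ P (x ∷ S) ⊎ Suffix _≡_ P (x ∷ S ∷ʳ a)
    split (inj₁ q)    = inj₁ (here q)
    split (inj₂ refl) = inj₂ suffix-refl
  infix-∷ʳ⁻ {S = x ∷ S} (there p) with infix-∷ʳ⁻ p
  ... | inj₁ q = inj₁ (there q)
  ... | inj₂ q = inj₂ (there q)

  ⊆-∷ʳ⁻ : ∀ {Z S : List A} {a} → Z ⊆ S ∷ʳ a → Z ⊆ S ⊎ ∃[ Z′ ] (Z ≡ Z′ ∷ʳ a × Z′ ⊆ S)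
  ⊆-∷ʳ⁻ {S = []} (omit _ p)    = inj₁ p
  ⊆-∷ʳ⁻ {S = []} (refl ∷ []) = inj₂ ([] , refl , [])
  ⊆-∷ʳ⁻ {S = x ∷ S} (omit _ p) with ⊆-∷ʳ⁻ p
  ... | inj₁ q             = inj₁ (omit x q)
  ... | inj₂ (Z′ , eq , q) = inj₂ (Z′ , eq , omit x q)
  ⊆-∷ʳ⁻ {S = x ∷ S} (refl ∷ p) with ⊆-∷ʳ⁻ p
  ... | inj₁ q               = inj₁ (refl ∷ q)
  ... | inj₂ (Z′ , refl , q) = inj₂ (x ∷ Z′ , refl , refl ∷ q)

  ⊆-∷ʳ : ∀ {Z S : List A} {a} → Z ⊆ S → Z ⊆ S ∷ʳ a
  ⊆-∷ʳ p = ⊆-trans p (++⁺ʳ _ ⊆-refl)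

module _ {q : ℕ} where

  longest-cong : ∀ {Q R : List (Fin q) → Set} {v} → (∀ {Z} → Q Z → R Z) → (∀ {Z} → R Z → Q Z) →
                 LongestLength Q v → LongestLength R v
  longest-cong Q⇒R R⇒Q ((Z , QZ , eq) , max) = (Z , Q⇒R QZ , eq) , λ Z RZ → max Z (R⇒Q RZ)

  longest-unique : ∀ {Q : List (Fin q) → Set} {v w} → LongestLength Q v → LongestLength Q w → v ≡ w
  longest-unique ((Z , QZ , refl) , maxᵛ) ((Z′ , QZ′ , refl) , maxʷ) = ≤-antisym (maxʷ Z QZ) (maxᵛ Z′ QZ′)

-- The automaton of σ

module _ {q : ℕ} {P : List (Fin q)} where

  σ-[] : P ⊢σ [] ≈ 0
  σ-[] = ([] , (suffix-refl , []) , refl) , λ U (p , _) → Suffixₚ.length-mono p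

  σ-≤-pattern : ∀ {S k} → P ⊢σ S ≈ k → k ≤ length P
  σ-≤-pattern ((_ , (_ , p) , refl) , _) = Prefixₚ.length-mono p

  σ-≤-string : ∀ {S k} → P ⊢σ S ≈ k → k ≤ length S
  σ-≤-string ((_ , (p , _) , refl) , _) = Suffixₚ.length-mono p

  σ-prefix : ∀ {U} → Prefix _≡_ U P → P ⊢σ U ≈ length U
  σ-prefix p = (_ , (suffix-refl , p) , refl) , λ V (s , _) → Suffixₚ.length-mono s

  σ-suffix : ∀ {S k} → P ⊢σ S ≈ k → Suffix _≡_ (take k P) S
  σ-suffix {S} ((U , (s , p) , refl) , _) = subst (λ V → Suffix _≡_ V S) (prefix-≡-take p) s

  σ<⇒¬suffix : ∀ {S k} → P ⊢σ S ≈ k → k < length P → ¬ Suffix _≡_ P S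
  σ<⇒¬suffix (_ , max) k< s = <⇒≱ k< (max P (s , Prefixₚ.fromPointwise (≡⇒Pointwise-≡ refl)))

  -- If σ reached `length P`, the prefix of `P` that witnesses it would be all of `P`, occurring as
  -- a suffix of `S`.
  ¬infix⇒σ< : ∀ {S k} → ¬ Infix _≡_ P S → P ⊢σ S ≈ k → k < length P
  ¬infix⇒σ< {S} ¬P⊑S ((U , (s , p) , refl) , _) = ≰⇒> λ P≤U →
    ¬P⊑S (Infixₚ.fromSuffix (subst (λ V → Suffix _≡_ V S)
      (Pointwise-≡⇒≡ (Prefixₚ.toPointwise (≤-antisym (Prefixₚ.length-mono p) P≤U) p)) s))

  -- If nonempty, `U` is `U′ ∷ʳ a`, where `U′` competes for σ(S) and so has length at most `k`. Of
  -- two suffixes of `S` the shorter is a suffix of the longer, which here is `take k P`.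
  σ-∷ʳ⁺ : ∀ {S k a U} → P ⊢σ S ≈ k → Prefix _≡_ U P → Suffix _≡_ U (S ∷ʳ a) → Suffix _≡_ U (take k P ∷ʳ a)
  σ-∷ʳ⁺ {k = k} σS p s with suffix-∷ʳ⁻ s
  ... | inj₁ refl            = suffix-[] _
  ... | inj₂ (U′ , refl , s′) = suffix-∷ʳ⁺ (suffix-linear s′ (σ-suffix σS)
          (≤-trans (proj₂ σS U′ (s′ , prefix-∷ʳ⁻ p)) (≤-reflexive (sym (length-take-≤ k P (σ-≤-pattern σS))))))

  σ-∷ʳ⁻ : ∀ {S k a U} → P ⊢σ S ≈ k → Suffix _≡_ U (take k P ∷ʳ a) → Suffix _≡_ U (S ∷ʳ a)
  σ-∷ʳ⁻ σS s = suffix-trans s (suffix-∷ʳ⁺ (σ-suffix σS))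

  σ-step : ∀ {S k a l} → P ⊢σ S ≈ k → P ⊢σ take k P ∷ʳ a ≈ l → P ⊢σ S ∷ʳ a ≈ l
  σ-step σS = longest-cong (λ (s , p) → σ-∷ʳ⁻ σS s , p) (λ (s , p) → σ-∷ʳ⁺ σS p s , p)

  infix-free-∷ʳ : ∀ {S a k} → ¬ Infix _≡_ P S → P ⊢σ S ∷ʳ a ≈ k → k < length P → ¬ Infix _≡_ P (S ∷ʳ a)
  infix-free-∷ʳ ¬P⊑S σSa k< P⊑Sa with infix-∷ʳ⁻ P⊑Sa
  ... | inj₁ P⊑S = ¬P⊑S P⊑S
  ... | inj₂ s   = σ<⇒¬suffix σSa k< s

-- The recurrence for f

module _ {q : ℕ} (P : List (Fin q)) where

  record Candidate (A B : List (Fin q)) (k : ℕ) (Z : List (Fin q)) : Set where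
    constructor candidate
    field
      ⊆ˡ         : Z ⊆ A
      ⊆ʳ         : Z ⊆ B
      infix-free : ¬ Infix _≡_ P Z
      state      : P ⊢σ Z ≈ k

  -- All f(i,0,k) and f(0,j,k) start at 0, although σ of the empty string is 0 and
  -- not k.  So an entry is witnessed by a common subsequence read by the automaton
  -- from an arbitrary state, that is, by a suffix of some P-free string in state k.
  record Attained (A B : List (Fin q)) (k v : ℕ) : Set where
    constructor attained
    field
      {word context} : List (Fin q)
      ⊆ˡ         : word ⊆ A
      ⊆ʳ         : word ⊆ B
      suffix     : Suffix _≡_ word context
      infix-free : ¬ Infix _≡_ P context
      state      : P ⊢σ context ≈ k
      len        : length word ≡ v

  -- The two halves concern different classes: the witness may be read from any state, the upper
  -- bound is for words read from state 0. A single `v` is therefore not determined, but the maximum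
  -- over all states below r is, because the words of both classes avoid `P`.
  record Optimal (A B : List (Fin q)) (k v : ℕ) : Set where
    constructor optimal
    field
      witness : Attained A B k v
      upper   : ∀ Z → Candidate A B k Z → length Z ≤ v

  open Optimal public

  attained-mono : ∀ {A A′ B B′ k v} → A ⊆ A′ → B ⊆ B′ → Attained A B k v → Attained A′ B′ k v
  attained-mono A⊆ B⊆ (attained ⊆ˡ ⊆ʳ suf free st len) =
    attained (⊆-trans ⊆ˡ A⊆) (⊆-trans ⊆ʳ B⊆) suf free st len

  attained-⊔ : ∀ {A B k u v} → Attained A B k u → Attained A B k v → Attained A B k (u ⊔ v)
  attained-⊔ {u = u} {v} p q with ⊔-sel u v
  ... | inj₁ eq = subst (Attained _ _ _) (sym eq) p
  ... | inj₂ eq = subst (Attained _ _ _) (sym eq) q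

  attained-∷ʳ : ∀ {A B a k l v} → Attained A B k v → P ⊢σ take k P ∷ʳ a ≈ l → l < length P →
                Attained (A ∷ʳ a) (B ∷ʳ a) l (suc v)
  attained-∷ʳ (attained {Z} {W} ⊆ˡ ⊆ʳ suf free st refl) trn l< =
    attained (++⁺ ⊆ˡ ⊆-refl) (++⁺ ⊆ʳ ⊆-refl) (suffix-∷ʳ⁺ suf)
      (infix-free-∷ʳ free (σ-step st trn) l<) (σ-step st trn) (length-∷ʳ Z)

  -- The empty word is read after the context `take k P`, which is in state `k` and, being shorter
  -- than `P`, cannot contain it.
  optimal-empty : ∀ {A B k} → k < length P → (∀ {Z} → Z ⊆ A → Z ⊆ B → length Z ≡ 0) → Optimal A B k 0
  optimal-empty {k = k} k< empty = optimal
    (attained (minimum _) (minimum _) (suffix-[] _)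
      (λ P⊑ → <⇒≱ k< (≤-trans (Infixₚ.length-mono P⊑) (≤-reflexive len)))
      (subst (P ⊢σ take k P ≈_) len (σ-prefix (take-prefix k P))) refl)
    (λ Z c → ≤-reflexive (empty (Candidate.⊆ˡ c) (Candidate.⊆ʳ c)))
    where len = length-take-≤ k P (<⇒≤ k<)

  record Skipping (A : List (Fin q)) (a : Fin q) (B : List (Fin q)) (b : Fin q) (k v : ℕ) : Set where
    constructor skipping
    field
      witness : Attained (A ∷ʳ a) (B ∷ʳ b) k v
      upper   : ∀ Z → Candidate A (B ∷ʳ b) k Z ⊎ Candidate (A ∷ʳ a) B k Z → length Z ≤ v

  -- The invariant of step 2(b) before round `κ`: matches of the two equal last letters are
  -- accounted for when the automaton comes from a state below `κ`.
  record Extending (κ : ℕ) (A B : List (Fin q)) (a : Fin q) (k v : ℕ) : Set where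
    constructor extending
    field
      skip  : Skipping A a B a k v
      upper : ∀ Z k′ → k′ < κ → Candidate A B k′ Z → P ⊢σ Z ∷ʳ a ≈ k → length Z < v

  skipping-⊔ : ∀ {A a B b k u v} → Optimal A (B ∷ʳ b) k u → Optimal (A ∷ʳ a) B k v →
               Skipping A a B b k (u ⊔ v)
  skipping-⊔ {u = u} {v} (optimal wit₁ up₁) (optimal wit₂ up₂) = skipping
    (attained-⊔ (attained-mono (⊆-∷ʳ ⊆-refl) ⊆-refl wit₁) (attained-mono ⊆-refl (⊆-∷ʳ ⊆-refl) wit₂))
    λ { Z (inj₁ c) → m≤n⇒m≤n⊔o v (up₁ Z c) ; Z (inj₂ c) → m≤n⇒m≤o⊔n u (up₂ Z c) }

  extending-zero : ∀ {A B a k v} → Skipping A a B a k v → Extending 0 A B a k v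
  extending-zero skip = extending skip λ _ _ ()

  extending-hit : ∀ {κ A B a l v w} → Extending κ A B a l v → Optimal A B κ w →
                  P ⊢σ take κ P ∷ʳ a ≈ l → l < length P → Extending (suc κ) A B a l (v ⊔ suc w)
  extending-hit {κ} {v = v} {w} (extending (skipping wit up) up′) opt trn l< = extending
    (skipping (attained-⊔ wit (attained-∷ʳ (opt .witness) trn l<)) λ Z c → m≤n⇒m≤n⊔o (suc w) (up Z c))
    λ Z k′ k′< c σZa → case-≤ Z k′ c σZa (m≤n⇒m<n∨m≡n (≤-pred k′<))
    where
    case-≤ : ∀ Z k′ → Candidate _ _ k′ Z → P ⊢σ Z ∷ʳ _ ≈ _ → k′ < κ ⊎ k′ ≡ κ → length Z < v ⊔ suc w
    case-≤ Z k′ c σZa (inj₁ k′<κ) = m≤n⇒m≤n⊔o (suc w) (up′ Z k′ k′<κ c σZa)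
    case-≤ Z k′ c σZa (inj₂ refl) = m≤n⇒m≤o⊔n v (s≤s (opt .upper Z c))

  extending-miss : ∀ {κ A B a k l v} → Extending κ A B a k v →
                   P ⊢σ take κ P ∷ʳ a ≈ l → l ≢ k → Extending (suc κ) A B a k v
  extending-miss {κ} {v = v} (extending skip up) trn l≢k = extending skip
    λ Z k′ k′< c σZa → case-≤ Z k′ c σZa (m≤n⇒m<n∨m≡n (≤-pred k′<))
    where
    case-≤ : ∀ Z k′ → Candidate _ _ k′ Z → P ⊢σ Z ∷ʳ _ ≈ _ → k′ < κ ⊎ k′ ≡ κ → length Z < v
    case-≤ Z k′ c σZa (inj₁ k′<κ) = up Z k′ k′<κ c σZa
    case-≤ Z k′ c σZa (inj₂ refl) =
      -- A word in state `κ` moves to `l` on reading `a`, and σ has only one value.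
      contradiction (longest-unique (σ-step (Candidate.state c) trn) σZa) l≢k

  module _ (1≤r : 1 ≤ length P)
           (transition : ∀ k → k < length P → ∀ a → ∃[ l ] P ⊢σ take k P ∷ʳ a ≈ l) where

    infix-free-∷ʳ⁻ : ∀ {Z a} → ¬ Infix _≡_ P (Z ∷ʳ a) → ¬ Infix _≡_ P Z
    infix-free-∷ʳ⁻ free P⊑Z = free (P⊑Z ⁱ++ _)

    -- Runs the automaton along `Z`: as long as no occurrence of `P` is met the state stays below r,
    -- where `transition` supplies the next one.
    σ-total : ∀ {Z} → ¬ Infix _≡_ P Z → ∃[ k ] (k < length P × P ⊢σ Z ≈ k)
    σ-total free = go (reverseView _) free
      where
      go : ∀ {Z} → Reverse Z → ¬ Infix _≡_ P Z → ∃[ k ] (k < length P × P ⊢σ Z ≈ k)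
      go []             _    = 0 , 1≤r , σ-[]
      go (Z ∶ rs ∶ʳ a) free =
        let k , k< , σZ = go rs (infix-free-∷ʳ⁻ free)
            l , trn     = transition k k< a
            σZa         = σ-step σZ trn
        in  l , ¬infix⇒σ< free σZa , σZa

    skips-or-matches : ∀ {A a B b k Z} → Candidate (A ∷ʳ a) (B ∷ʳ b) k Z →
                       (Candidate A (B ∷ʳ b) k Z ⊎ Candidate (A ∷ʳ a) B k Z) ⊎
                       ∃[ Z′ ] ∃[ k′ ] (Z ≡ Z′ ∷ʳ a × a ≡ b × k′ < length P × Candidate A B k′ Z′)
    skips-or-matches (candidate ⊆ˡ ⊆ʳ free st) with ⊆-∷ʳ⁻ ⊆ˡ | ⊆-∷ʳ⁻ ⊆ʳ
    ... | inj₁ p | _      = inj₁ (inj₁ (candidate p ⊆ʳ free st))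
    ... | inj₂ _ | inj₁ q = inj₁ (inj₂ (candidate ⊆ˡ q free st))
    -- Both decompositions split off the last letter of the same string, so the two letters are
    -- equal.
    ... | inj₂ (Z′ , refl , p) | inj₂ (Z″ , eq , q) with refl , refl ← ∷ʳ-injective Z′ Z″ eq =
      let k′ , k′< , σZ′ = σ-total (infix-free-∷ʳ⁻ free)
      in  inj₂ (Z′ , k′ , refl , refl , k′< , candidate p q (infix-free-∷ʳ⁻ free) σZ′)

    skipping-optimal : ∀ {A a B b k v} → a ≢ b → Skipping A a B b k v → Optimal (A ∷ʳ a) (B ∷ʳ b) k v
    skipping-optimal {A} {a} {B} {b} {k} {v} a≢b (skipping wit up) = optimal wit bounded
      where
      bounded : ∀ Z → Candidate (A ∷ʳ a) (B ∷ʳ b) k Z → length Z ≤ v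
      bounded Z c with skips-or-matches c
      ... | inj₁ skips                   = up Z skips
      ... | inj₂ (_ , _ , _ , a≡b , _) = contradiction a≡b a≢b

    extending-optimal : ∀ {A B a k v} → Extending (length P) A B a k v → Optimal (A ∷ʳ a) (B ∷ʳ a) k v
    extending-optimal {A} {B} {a} {k} {v} (extending (skipping wit up) up′) = optimal wit bounded
      where
      bounded : ∀ Z → Candidate (A ∷ʳ a) (B ∷ʳ a) k Z → length Z ≤ v
      bounded Z c with skips-or-matches c
      ... | inj₁ skips = up Z skips
      ... | inj₂ (Z′ , k′ , refl , _ , k′< , c′) =
        ≤-trans (≤-reflexive (length-∷ʳ Z′)) (up′ Z′ k′ k′< c′ (Candidate.state c))

    -- A suffix of a context that avoids `P` avoids it too, whatever state the word was read from.
    attained-feasible : ∀ {X Y k v} → Attained X Y k v → ∃[ Z ] (Feasible X Y P Z × length Z ≡ v)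
    attained-feasible (attained ⊆ˡ ⊆ʳ suf free _ len) =
      _ , (⊆ˡ , ⊆ʳ , λ P⊑Z → free (Infixₚ.Infix-Suffix-trans trans P⊑Z suf)) , len

    []-feasible : ∀ {X Y} → Feasible X Y P []
    []-feasible = minimum _ , minimum _ , λ P⊑[] → <⇒≱ 1≤r (Infixₚ.length-mono P⊑[])

    feasible-≤ : ∀ {X Y v} {g : ℕ → ℕ} → (∀ k → k < length P → Optimal X Y k (g k)) →
                 (∀ k → k < length P → g k ≤ v) → ∀ Z → Feasible X Y P Z → length Z ≤ v
    feasible-≤ opt g≤v Z (⊆ˡ , ⊆ʳ , free) =
      let k , k< , σZ = σ-total free
      in  ≤-trans (opt k k< .upper Z (candidate ⊆ˡ ⊆ʳ free σZ)) (g≤v k k<)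

-- Algorithm A

triple-≡ : ∀ {a a′ b b′ c c′ : ℕ} → a ≡ a′ → b ≡ b′ → c ≡ c′ →
           _≡_ {A = List ℕ} (a ∷ b ∷ c ∷ []) (a′ ∷ b′ ∷ c′ ∷ [])
triple-≡ refl refl refl = refl

index : ∀ v {n} → 1 ≤ v → v ≤ n → ∃[ i ] v ≡ suc (toℕ {n} i)
index (suc v) _ v< = fromℕ< v< , cong suc (sym (toℕ-fromℕ< v<))

≤-∸1 : ∀ {k n} → 1 ≤ n → k ≤ n ∸ 1 → k < n
≤-∸1 {n = suc n} _ k≤ = s≤s k≤

suc-∸1 : ∀ {n} → 1 ≤ n → suc (n ∸ 1) ≡ n
suc-∸1 {suc n} _ = refl

costᴬ : ℕ → ℕ → ℕ → ℕ
costᴬ n m r =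
  ((4 + suc n * (2 + (4 + suc r * 7))) + (4 + suc m * (2 + (4 + suc r * 7)))) +
  ((4 + n * (2 + (4 + m * (2 + ((4 + suc r * 19) + (5 + (6 + suc (r ∸ 1) * 26))))))) +
   (2 + (6 + suc (r ∸ 1) * 9)))

bound-algorithmA : ∀ s → bound s algorithmA ≡ costᴬ (s (nᵛ , [])) (s (mᵛ , [])) (s (rᵛ , []))
bound-algorithmA s = refl

-- 196 is `costᴬ 1 1 1`. With every variable shifted by one, the difference of the two sides is a
-- polynomial with natural coefficients and no constant term, namely the last summand on the left of
-- `slack`.
costᴬ-≤ : ∀ {n m r} → 1 ≤ n → 1 ≤ m → 1 ≤ r → costᴬ n m r ≤ 196 * (n * m * r)
costᴬ-≤ {suc n} {suc m} {suc r} _ _ _ = m+n≤o⇒m≤o _ (≤-reflexive (slack n m r))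
  where
  slack : ∀ n m r →
    ((4 + (2 + n) * (2 + (4 + (2 + r) * 7))) + (4 + (2 + m) * (2 + (4 + (2 + r) * 7)))) +
    ((4 + (1 + n) * (2 + (4 + (1 + m) * (2 + ((4 + (2 + r) * 19) + (5 + (6 + (1 + r) * 26))))))) +
     (2 + (6 + (1 + r) * 9))) +
    (89 * n + 95 * m + 114 * r + 115 * (n * m) + 144 * (n * r) + 144 * (m * r) + 151 * (n * m * r)) ≡
    196 * ((1 + n) * (1 + m) * (1 + r))
  slack = solve-∀

module Correctness {q} (X Y P : List (Fin q)) (1≤r : 1 ≤ length P) (s₀ : Store)
  (texts : HoldsTexts X Y s₀) (pattern′ : HoldsPattern P s₀) (table : HoldsTable P s₀) where

  open Frame (writes algorithmA)

  N M R : ℕ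
  N = length X
  M = length Y
  R = length P

  -- In this and the next lemmas, `refl` checks by computation that the program never writes the
  -- name in question, so inputs and table survive in every store agreeing with `s₀`.
  n≡ : ∀ {s} → s₀ ≈ s → s (nᵛ , []) ≡ N
  n≡ h = trans (h .unchanged nᵛ [] refl) (texts .X-cells .len-cell)

  m≡ : ∀ {s} → s₀ ≈ s → s (mᵛ , []) ≡ M
  m≡ h = trans (h .unchanged mᵛ [] refl) (texts .Y-cells .len-cell)

  r≡ : ∀ {s} → s₀ ≈ s → s (rᵛ , []) ≡ R
  r≡ h = trans (h .unchanged rᵛ [] refl) (pattern′ .pattern-cells .len-cell)

  x≡ : ∀ {s} → s₀ ≈ s → ∀ u → s (xᵃ , suc (toℕ u) ∷ []) ≡ toℕ (lookup X u)
  x≡ h u = trans (h .unchanged xᵃ _ refl) (texts .X-cells .char-cells u)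

  y≡ : ∀ {s} → s₀ ≈ s → ∀ u → s (yᵃ , suc (toℕ u) ∷ []) ≡ toℕ (lookup Y u)
  y≡ h u = trans (h .unchanged yᵃ _ refl) (texts .Y-cells .char-cells u)

  λ≡ : ∀ {s} → s₀ ≈ s → ∀ k → k < R → ∀ a → P ⊢σ take k P ∷ʳ a ≈ s (λᵃ , k ∷ toℕ a ∷ [])
  λ≡ h k k< a = subst (P ⊢σ take k P ∷ʳ a ≈_) (sym (h .unchanged λᵃ _ refl)) (table k k< a)

  transition : ∀ k → k < R → ∀ a → ∃[ l ] P ⊢σ take k P ∷ʳ a ≈ l
  transition k k< a = _ , table k k< a

  -- Initialisation of the border

  Zeros : (ℕ → ℕ → ℕ → Set) → Store → Set
  Zeros D s = ∀ a b c → D a b c → s (fᵃ , a ∷ b ∷ c ∷ []) ≡ 0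

  write-zero : ∀ {D D′ s u v w} →
               (∀ a b c → D′ a b c → D a b c ⊎ (fᵃ , u ∷ v ∷ w ∷ []) ≡ (fᵃ , a ∷ b ∷ c ∷ [])) →
               Zeros D s → Zeros D′ (s [ fᵃ , u ∷ v ∷ w ∷ [] ↦ 0 ])
  write-zero {s = s} D′⊆ zeros a b c d =
    update-elim (_≡ 0) s (fᵃ , _) (fᵃ , _) (λ _ → refl) λ ne → old ne (D′⊆ a b c d)
    where
    old : _ ≢ _ → _ ⊎ _ → s (fᵃ , a ∷ b ∷ c ∷ []) ≡ 0
    old _  (inj₁ d) = zeros a b c d
    old ne (inj₂ eq) = contradiction eq ne

  extend-lex : ∀ {u w a c} → a < u ⊎ a ≡ u × c < suc w → (a < u ⊎ a ≡ u × c < w) ⊎ u ≡ a × w ≡ c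
  extend-lex (inj₁ a<u) = inj₁ (inj₁ a<u)
  extend-lex (inj₂ (refl , c<)) with m≤n⇒m<n∨m≡n (≤-pred c<)
  ... | inj₁ c<w  = inj₁ (inj₂ (refl , c<w))
  ... | inj₂ refl = inj₂ (refl , refl)

  -- Progress of the nested loops in lexicographic order: lines before `u` are complete, and line
  -- `u` is written below `w`.
  Column Row : ℕ → ℕ → ℕ → ℕ → ℕ → Set
  Column u w a b c = b ≡ 0 × c ≤ R × (a < u ⊎ a ≡ u × c < w)
  Row    u w a b c = a ≡ 0 × c ≤ R × (b < u ⊎ b ≡ u × c < w)

  Border : ℕ → ℕ → ℕ → Set
  Border a b c = Column (suc N) 0 a b c ⊎ Row (suc M) 0 a b c

  -- With `c ≤ R`, the positions `(suc u , 0)` and `(u , suc R)` describe the same progress, which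
  -- links the inner loop to the outer one.
  next-line : ∀ {u a c} → c ≤ R → a < suc u ⊎ a ≡ suc u × c < 0 → a < u ⊎ a ≡ u × c < suc R
  next-line c≤ (inj₁ a<) with m≤n⇒m<n∨m≡n (≤-pred a<)
  ... | inj₁ a<u  = inj₁ a<u
  ... | inj₂ refl = inj₂ (refl , s≤s c≤)

  initialise-zeros : ⟨ s₀ ≈_ ⟩ initialise ⟨ (λ s → s₀ ≈ s × Zeros Border s) ⟩
  initialise-zeros =
    consequence (λ s≈ → s≈ , λ { a b c (_ , _ , inj₁ ()) ; a b c (_ , _ , inj₂ (_ , ())) })
      id column ⨟
    consequence (λ (s≈ , z) → s≈ , λ { a b c (inj₁ d) → z a b c d
                                     ; a b c (inj₂ (_ , _ , inj₁ ()))
                                     ; a b c (inj₂ (_ , _ , inj₂ (_ , ()))) })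
      id row
    where
    column : ⟨ (λ s → s₀ ≈ s × Zeros (Column 0 0) s) ⟩ _ ⟨ (λ s → s₀ ≈ s × Zeros (Column (suc N) 0) s) ⟩
    column = for-rule (λ v s → s₀ ≈ s × Zeros (Column v 0) s) z≤n (n≡ ∘ proj₁)
      (λ (s≈ , z) → ≈-update iᵛ [] refl s≈ , z)
      λ u _ _ → consequence
        (λ ((s≈ , z) , i≡) → s≈ , i≡ , z)
        (λ (s≈ , _ , z) → s≈ , λ a b c (b≡ , c≤ , d) → z a b c (b≡ , c≤ , next-line c≤ d))
        (for-rule (λ w s → s₀ ≈ s × s (iᵛ , []) ≡ u × Zeros (Column u w) s) z≤n (r≡ ∘ proj₁)
          (λ (s≈ , i≡ , z) → ≈-update kᵛ [] refl s≈ , i≡ , z)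
          λ w _ _ → assign-rule λ {s} ((s≈ , i≡ , z) , k≡) →
            u ∷ 0 ∷ w ∷ [] , 0 , triple-≡ i≡ refl k≡ , refl , ≈-update fᵃ _ refl s≈ , i≡ ,
            write-zero {Column u w} {s = s} (λ { a b c (refl , c≤ , d) → case-⊎ c≤ (extend-lex d) }) z)
      where
      case-⊎ : ∀ {u w a c} → c ≤ R → (a < u ⊎ a ≡ u × c < w) ⊎ u ≡ a × w ≡ c →
               Column u w a 0 c ⊎ (fᵃ , u ∷ 0 ∷ w ∷ []) ≡ (fᵃ , a ∷ 0 ∷ c ∷ [])
      case-⊎ c≤ (inj₁ d)             = inj₁ (refl , c≤ , d)
      case-⊎ c≤ (inj₂ (refl , refl)) = inj₂ refl

    Both : ℕ → ℕ → ℕ → ℕ → ℕ → Set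
    Both u w a b c = Column (suc N) 0 a b c ⊎ Row u w a b c

    row : ⟨ (λ s → s₀ ≈ s × Zeros (Both 0 0) s) ⟩ _ ⟨ (λ s → s₀ ≈ s × Zeros (Both (suc M) 0) s) ⟩
    row = for-rule (λ v s → s₀ ≈ s × Zeros (Both v 0) s) z≤n (m≡ ∘ proj₁)
      (λ (s≈ , z) → ≈-update jᵛ [] refl s≈ , z)
      λ u _ _ → consequence
        (λ ((s≈ , z) , j≡) → s≈ , j≡ , z)
        (λ (s≈ , _ , z) → s≈ , λ { a b c (inj₁ d) → z a b c (inj₁ d)
                                 ; a b c (inj₂ (a≡ , c≤ , d)) → z a b c (inj₂ (a≡ , c≤ , next-line c≤ d)) })
        (for-rule (λ w s → s₀ ≈ s × s (jᵛ , []) ≡ u × Zeros (Both u w) s) z≤n (r≡ ∘ proj₁)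
          (λ (s≈ , j≡ , z) → ≈-update kᵛ [] refl s≈ , j≡ , z)
          λ w _ _ → assign-rule λ {s} ((s≈ , j≡ , z) , k≡) →
            0 ∷ u ∷ w ∷ [] , 0 , triple-≡ refl j≡ k≡ , refl , ≈-update fᵃ _ refl s≈ , j≡ ,
            write-zero {Both u w} {s = s} (λ { a b c (inj₁ d) → inj₁ (inj₁ d)
                         ; a b c (inj₂ (refl , c≤ , d)) → case-⊎ c≤ (extend-lex d) }) z)
      where
      case-⊎ : ∀ {u w b c} → c ≤ R → (b < u ⊎ b ≡ u × c < w) ⊎ u ≡ b × w ≡ c →
               Both u w 0 b c ⊎ (fᵃ , 0 ∷ u ∷ w ∷ []) ≡ (fᵃ , 0 ∷ b ∷ c ∷ [])
      case-⊎ c≤ (inj₁ d)             = inj₁ (inj₂ (refl , c≤ , d))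
      case-⊎ c≤ (inj₂ (refl , refl)) = inj₂ refl

  -- The main loop

  Filled : (ℕ → ℕ → Set) → Store → Set
  Filled D s = ∀ a b k → D a b → k < R → Optimal P (take a X) (take b Y) k (s (fᵃ , a ∷ b ∷ k ∷ []))

  -- Complete rows, then column 0, which initialisation has filled for all rows in advance, then the
  -- current row up to `v`.
  Done : ℕ → ℕ → ℕ → ℕ → Set
  Done u v a b = (a < u × b ≤ M) ⊎ (a ≤ N × b ≡ 0) ⊎ (a ≡ u × b < v)

  ¬done : ∀ {u v} → ¬ Done (suc u) (suc v) (suc u) (suc v)
  ¬done (inj₁ (lt , _))        = <-irrefl refl lt
  ¬done (inj₂ (inj₂ (_ , lt))) = <-irrefl refl lt

  write-elsewhere : ∀ {D s u v w x} → ¬ D u v → Filled D s → Filled D (s [ fᵃ , u ∷ v ∷ w ∷ [] ↦ x ])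
  write-elsewhere {s = s} {u} {v} {w} ¬d filled a b k d k< =
    update-elim (Optimal P _ _ k) s (fᵃ , u ∷ v ∷ w ∷ []) (fᵃ , a ∷ b ∷ k ∷ [])
      (λ { refl → contradiction d ¬d }) λ _ → filled a b k d k<

  module Entry (u : Fin N) (v : Fin M) where

    a b : Fin q
    a = lookup X u
    b = lookup Y v

    A B : List (Fin q)
    A = take (toℕ u) X
    B = take (toℕ v) Y

    i₁ j₁ : ℕ
    i₁ = suc (toℕ u)
    j₁ = suc (toℕ v)

    entry : ℕ → Cell
    entry k = fᵃ , i₁ ∷ j₁ ∷ k ∷ []

    Context : Store → Set
    Context s = s₀ ≈ s × s (iᵛ , []) ≡ i₁ × s (jᵛ , []) ≡ j₁ × Filled (Done i₁ j₁) s

    context-entry : ∀ {s} k {x} → Context s → Context (s [ entry k ↦ x ])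
    context-entry {s} k (s≈ , i≡ , j≡ , filled) = ≈-update fᵃ _ refl s≈ , i≡ , j≡ , write-elsewhere {s = s} {w = k} ¬done filled

    above : ∀ {s k} → Context s → k < R → Optimal P A (B ∷ʳ b) k (s (fᵃ , toℕ u ∷ j₁ ∷ k ∷ []))
    above {s} {k} (_ , _ , _ , filled) k< = subst (λ T → Optimal P A T k (s (fᵃ , toℕ u ∷ j₁ ∷ k ∷ []))) (take-suc Y v)
      (filled _ _ _ (inj₁ (≤-refl , toℕ<n v)) k<)

    left : ∀ {s k} → Context s → k < R → Optimal P (A ∷ʳ a) B k (s (fᵃ , i₁ ∷ toℕ v ∷ k ∷ []))
    left {s} {k} (_ , _ , _ , filled) k< = subst (λ T → Optimal P T B k (s (fᵃ , i₁ ∷ toℕ v ∷ k ∷ []))) (take-suc X u)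
      (filled _ _ _ (inj₂ (inj₂ (refl , ≤-refl))) k<)

    diagonal : ∀ {s k} → Context s → k < R → Optimal P A B k (s (fᵃ , toℕ u ∷ toℕ v ∷ k ∷ []))
    diagonal (_ , _ , _ , filled) k< = filled _ _ _ (inj₁ (≤-refl , <⇒≤ (toℕ<n v))) k<

    -- Step 2(a) runs up to `k = r`, while the neighbouring entries are known only below r; hence
    -- both bounds on `k`.
    Skipped : ℕ → Store → Set
    Skipped κ s = Context s × ∀ k → k < κ → k < R → Skipping P A a B b k (s (entry k))

    stepA-skips : ⟨ Context ⟩ stepA ⟨ Skipped (suc R) ⟩
    stepA-skips = consequence (λ c → c , λ _ ()) id
      (for-rule Skipped z≤n (r≡ ∘ proj₁ ∘ proj₁)
        (λ ((s≈ , c) , sk) → (≈-update kᵛ [] refl s≈ , c) , sk)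
        λ κ _ _ → assign-rule λ {s} ((ctx@(_ , i≡ , j≡ , _) , sk) , k≡) →
          _ , _ , triple-≡ i≡ j≡ k≡ ,
          cong₂ _⊔_ (cong (λ is → s (fᵃ , is)) (triple-≡ (cong (_∸ 1) i≡) j≡ k≡))
                    (cong (λ is → s (fᵃ , is)) (triple-≡ i≡ (cong (_∸ 1) j≡) k≡)) ,
          context-entry κ ctx ,
          λ k k<sκ k<R → update-elim (Skipping P A a B b k) s (entry κ) (entry k)
            (λ { refl → skipping-⊔ P (above ctx k<R) (left ctx k<R) })
            (λ κ≢k → sk k (≤∧≢⇒< (≤-pred k<sκ) λ { refl → κ≢k refl }) k<R))

    Extended : ℕ → Store → Set
    Extended κ s = Context s × ∀ k → k < R → Extending P κ A B a k (s (entry k))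

    Solved : Store → Set
    Solved s = Context s × ∀ k → k < R → Optimal P (A ∷ʳ a) (B ∷ʳ b) k (s (entry k))

    extend : ⟨ Extended 0 ⟩
             for kᵛ from # 0 to r ∸ᵉ # 1 perform
               (tᵛ [ [] ]:= λᵃ [ k ∷ xᵃ [ i ∷ [] ] ∷ [] ] ⨾
                f⟨ i , j , t ⟩:= f i j t ⊔ᵉ (# 1 +ᵉ f (i ∸ᵉ # 1) (j ∸ᵉ # 1) k))
             ⟨ Extended (suc (R ∸ 1)) ⟩
    extend = for-rule Extended z≤n (cong (_∸ 1) ∘ r≡ ∘ proj₁ ∘ proj₁)
      (λ ((s≈ , c) , ex) → (≈-update kᵛ [] refl s≈ , c) , ex)
      λ κ _ κ≤ → let κ<R = ≤-∸1 1≤r κ≤ in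
        assign-rule {B = Reading κ}
          (λ {s} ((ctx@(s≈ , i≡ , c) , ex) , k≡) → _ , _ , refl ,
            cong₂ (λ k x → s (λᵃ , k ∷ x ∷ [])) k≡ (trans (cong (λ i → s (xᵃ , i ∷ [])) i≡) (x≡ s≈ u)) ,
            ((≈-update tᵛ [] refl s≈ , i≡ , c) , ex) , k≡ , λ≡ s≈ κ κ<R a) ⨟
        assign-rule λ {s} ((ctx@(_ , i≡ , j≡ , _) , ex) , k≡ , trn) →
          _ , _ , triple-≡ i≡ j≡ refl ,
          cong₂ _⊔_ (cong (λ is → s (fᵃ , is)) (triple-≡ i≡ j≡ refl))
            (cong (λ is → suc (s (fᵃ , is))) (triple-≡ (cong (_∸ 1) i≡) (cong (_∸ 1) j≡) k≡)) ,
          context-entry (s (tᵛ , [])) ctx ,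
          λ k k<R → update-elim (Extending P (suc κ) A B a k) s (entry (s (tᵛ , []))) (entry k)
            -- Here `k` is the state just written. A transition into r never gets here, because
            -- `k < R`.
            (λ { refl → extending-hit P (ex k k<R) (diagonal ctx κ<R) trn k<R })
            (λ t≢k → extending-miss P (ex k k<R) trn λ { refl → t≢k refl })
      where
      Reading : ℕ → Store → Set
      Reading κ s = Extended κ s × s (kᵛ , []) ≡ κ × P ⊢σ take κ P ∷ʳ a ≈ s (tᵛ , [])

    stepB-solves : ⟨ Skipped (suc R) ⟩ stepB ⟨ Solved ⟩
    stepB-solves = when-rule
      (consequence
        (λ {s} ((ctx@(s≈ , i≡ , j≡ , _) , sk) , same) →
          let a≡b = toℕ-injective (trans (sym (read-x ctx)) (trans same (read-y ctx)))
          -- `Extending` has a single letter for both ends, so `a ≡ b` is used on entry and kept,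
          -- being independent of the store, to restore `b` on exit.
          in  a≡b , ctx , λ k k<R → extending-zero P
                (subst (λ b → Skipping P A a B b k (s (entry k))) (sym a≡b) (sk k (m≤n⇒m≤1+n k<R) k<R)))
        (λ {s} (a≡b , ctx , ex) → ctx , λ k k<R →
          subst (λ b → Optimal P (A ∷ʳ a) (B ∷ʳ b) k (s (entry k))) a≡b
            (extending-optimal P 1≤r transition
              (subst (λ κ → Extending P κ A B a k (s (entry k))) (suc-∸1 1≤r) (ex k k<R))))
        (carry extend))
      λ (ctx , sk) x≢y → ctx , λ k k<R →
        skipping-optimal P 1≤r transition
          (λ a≡b → x≢y (trans (read-x ctx) (trans (cong toℕ a≡b) (sym (read-y ctx)))))
          (sk k (m≤n⇒m≤1+n k<R) k<R)
      where
      carry : ∀ {C : Set} {F c G} → ⟨ F ⟩ c ⟨ G ⟩ → ⟨ (λ s → C × F s) ⟩ c ⟨ (λ s → C × G s) ⟩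
      carry h .run (x , Fs) = x , h .run Fs
      read-x : ∀ {s} → Context s → s (xᵃ , s (iᵛ , []) ∷ []) ≡ toℕ a
      read-x {s} (s≈ , i≡ , _) = trans (cong (λ i → s (xᵃ , i ∷ [])) i≡) (x≡ s≈ u)
      read-y : ∀ {s} → Context s → s (yᵃ , s (jᵛ , []) ∷ []) ≡ toℕ b
      read-y {s} (s≈ , _ , j≡ , _) = trans (cong (λ j → s (yᵃ , j ∷ [])) j≡) (y≡ s≈ v)

    fill-entry : ⟨ Context ⟩ stepA ⨾ stepB
                 ⟨ (λ s → s₀ ≈ s × s (iᵛ , []) ≡ i₁ × Filled (Done i₁ (suc j₁)) s) ⟩
    fill-entry = stepA-skips ⨟ consequence id add stepB-solves
      where
      add : ∀ {s} → Solved s → s₀ ≈ s × s (iᵛ , []) ≡ i₁ × Filled (Done i₁ (suc j₁)) s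
      add {s} ((s≈ , i≡ , _ , filled) , opt) = s≈ , i≡ , new
        where
        new : Filled (Done i₁ (suc j₁)) s
        new a b k (inj₁ d)        k<R = filled a b k (inj₁ d) k<R
        new a b k (inj₂ (inj₁ d)) k<R = filled a b k (inj₂ (inj₁ d)) k<R
        new a b k (inj₂ (inj₂ (refl , b<))) k<R with m≤n⇒m<n∨m≡n (≤-pred b<)
        ... | inj₁ b<j₁ = filled a b k (inj₂ (inj₂ (refl , b<j₁))) k<R
        ... | inj₂ refl = subst₂ (λ S T → Optimal P S T k (s (entry k)))
                            (sym (take-suc X u)) (sym (take-suc Y v)) (opt k k<R)

  mainLoop-fills : ⟨ (λ s → s₀ ≈ s × Filled (Done 1 0) s) ⟩ mainLoop ⟨ (λ s → s₀ ≈ s × Filled (Done (suc N) 0) s) ⟩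
  mainLoop-fills = for-rule (λ i s → s₀ ≈ s × Filled (Done i 0) s) (s≤s z≤n) (n≡ ∘ proj₁)
    (λ (s≈ , filled) → ≈-update iᵛ [] refl s≈ , filled)
    λ i 1≤i i≤N → consequence
      (λ ((s≈ , filled) , i≡) → s≈ , i≡ , λ a b k d → filled a b k (enter i≤N d))
      (λ (s≈ , _ , filled) → s≈ , λ a b k d → filled a b k (leave d))
      (for-rule (λ j s → s₀ ≈ s × s (iᵛ , []) ≡ i × Filled (Done i j) s) (s≤s z≤n) (m≡ ∘ proj₁)
        (λ (s≈ , i≡ , filled) → ≈-update jᵛ [] refl s≈ , i≡ , filled)
        λ j 1≤j j≤M → inner (index i 1≤i i≤N) (index j 1≤j j≤M))
    where
    -- The inner loop starts at 1, not 0: the cell in column 0 of row `i` already belongs to the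
    -- border.
    enter : ∀ {i a b} → i ≤ N → Done i 1 a b → Done i 0 a b
    enter i≤N (inj₁ d)                    = inj₁ d
    enter i≤N (inj₂ (inj₁ d))             = inj₂ (inj₁ d)
    enter i≤N (inj₂ (inj₂ (refl , s≤s b≤))) = inj₂ (inj₁ (i≤N , n≤0⇒n≡0 b≤))
    leave : ∀ {i a b} → Done (suc i) 0 a b → Done i (suc M) a b
    leave (inj₁ (a< , b≤)) with m≤n⇒m<n∨m≡n (≤-pred a<)
    ... | inj₁ a<i  = inj₁ (a<i , b≤)
    ... | inj₂ refl = inj₂ (inj₂ (refl , s≤s b≤))
    leave (inj₂ (inj₁ d)) = inj₂ (inj₁ d)
    inner : ∀ {i j} → ∃[ u ] i ≡ suc (toℕ {N} u) → ∃[ v ] j ≡ suc (toℕ {M} v) →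
            ⟨ (λ s → (s₀ ≈ s × s (iᵛ , []) ≡ i × Filled (Done i j) s) × s (jᵛ , []) ≡ j) ⟩ stepA ⨾ stepB
            ⟨ (λ s → s₀ ≈ s × s (iᵛ , []) ≡ i × Filled (Done i (suc j)) s) ⟩
    inner (u , refl) (v , refl) = consequence (λ ((s≈ , i≡ , filled) , j≡) → s≈ , i≡ , j≡ , filled) id
      (Entry.fill-entry u v)

  border-filled : ∀ {s} → Zeros Border s → Filled (Done 1 0) s
  border-filled {s} zeros a b k (inj₁ (a<1 , b≤)) k<R with n≤0⇒n≡0 (≤-pred a<1)
  ... | refl = subst (Optimal P _ _ k) (sym (zeros 0 b k (inj₂ (refl , <⇒≤ k<R , inj₁ (s≤s b≤)))))
                 (optimal-empty P k<R λ Z⊆ _ → n≤0⇒n≡0 (length-mono-≤ Z⊆))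
  border-filled zeros a b k (inj₂ (inj₁ (a≤ , refl))) k<R =
    subst (Optimal P _ _ k) (sym (zeros a 0 k (inj₁ (refl , <⇒≤ k<R , inj₁ (s≤s a≤)))))
      (optimal-empty P k<R λ _ Z⊆ → n≤0⇒n≡0 (length-mono-≤ Z⊆))

  -- At every moment `outᵛ` is the length of some feasible string and dominates the entries
  -- inspected so far. Every feasible string is in some state below r, so at the end it is dominated
  -- too.
  result-maximum : ⟨ (λ s → s₀ ≈ s × Filled (Done (suc N) 0) s) ⟩ result
                   ⟨ (λ s → STR-EC-LCS X Y P (s (outᵛ , []))) ⟩
  result-maximum =
    assign-rule {B = Maximum 0} (λ {s} (s≈ , filled) → _ , _ , refl , refl ,
      ≈-update outᵛ [] refl s≈ ,
      (λ k k<R → subst₂ (λ S T → Optimal P S T k (s (fᵃ , N ∷ M ∷ k ∷ [])))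
        (take-all N X ≤-refl) (take-all M Y ≤-refl) (filled N M k (inj₁ (≤-refl , ≤-refl)) k<R)) ,
      -- The initial 0 is attained by the empty string, which avoids `P` because r is positive.
      ([] , []-feasible P 1≤r transition , refl) , λ _ ()) ⨟
    consequence id
      (λ (s≈ , opt , reached , max) → reached ,
        feasible-≤ P 1≤r transition opt λ k k<R → max k (≤-trans k<R (≤-reflexive (sym (suc-∸1 1≤r)))))
      (for-rule Maximum z≤n (cong (_∸ 1) ∘ r≡ ∘ proj₁)
        (λ (s≈ , rest) → ≈-update tᵛ [] refl s≈ , rest)
        λ κ _ κ≤ → assign-rule λ {s} ((s≈ , opt , reached , max) , t≡) →
          _ , _ , refl ,
          cong (λ is → s (outᵛ , []) ⊔ s (fᵃ , is)) (triple-≡ (n≡ s≈) (m≡ s≈) t≡) ,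
          ≈-update outᵛ [] refl s≈ , opt ,
          best (opt κ (≤-∸1 1≤r κ≤)) reached ,
          λ k k<sκ → bound-⊔ (max k) (m≤n⇒m<n∨m≡n (≤-pred k<sκ)))
    where
    Maximum : ℕ → Store → Set
    Maximum κ s = s₀ ≈ s × (∀ k → k < R → Optimal P X Y k (s (fᵃ , N ∷ M ∷ k ∷ []))) ×
      (∃[ Z ] (Feasible X Y P Z × length Z ≡ s (outᵛ , []))) ×
      (∀ k → k < κ → s (fᵃ , N ∷ M ∷ k ∷ []) ≤ s (outᵛ , []))
    best : ∀ {k o x} → Optimal P X Y k x → ∃[ Z ] (Feasible X Y P Z × length Z ≡ o) →
           ∃[ Z ] (Feasible X Y P Z × length Z ≡ o ⊔ x)
    best {o = o} {x} opt reached with ⊔-sel o x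
    ... | inj₁ eq rewrite eq = reached
    ... | inj₂ eq rewrite eq = attained-feasible P 1≤r transition (opt .witness)
    bound-⊔ : ∀ {k κ o} {g : ℕ → ℕ} → (k < κ → g k ≤ o) → k < κ ⊎ k ≡ κ → g k ≤ o ⊔ g κ
    bound-⊔ {κ = κ} {o} {g} max (inj₁ k<κ) = m≤n⇒m≤n⊔o (g κ) (max k<κ)
    bound-⊔ {κ = κ} {o} {g} max (inj₂ refl) = m≤n⊔m o (g κ)

  algorithmA-correct : ⟨ s₀ ≈_ ⟩ algorithmA ⟨ (λ s → STR-EC-LCS X Y P (s (outᵛ , []))) ⟩
  algorithmA-correct =
    initialise-zeros ⨟ consequence (λ {s} (s≈ , z) → s≈ , border-filled {s} z) id mainLoop-fills ⨟ result-maximum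

  algorithmA-time : 1 ≤ N → 1 ≤ M → time (exec algorithmA s₀) ≤ 196 * (N * M * R)
  algorithmA-time 1≤n 1≤m =
    ≤-trans (exec-time algorithmA refl s₀)
      (≤-trans (≤-reflexive (trans (bound-algorithmA s₀) inputs)) (costᴬ-≤ 1≤n 1≤m 1≤r))
    where
    inputs : costᴬ (s₀ (nᵛ , [])) (s₀ (mᵛ , [])) (s₀ (rᵛ , [])) ≡ costᴬ N M R
    inputs rewrite n≡ {s₀} ≈-refl | m≡ {s₀} ≈-refl | r≡ {s₀} ≈-refl = refl

-- Preprocessing

module _ {q} {P : List (Fin q)} where

  -- The only suffix lost by dropping the first letter is `S` itself, which does not compete when it
  -- is not a prefix of `P`.
  σ-drop : ∀ {S v} → ¬ Prefix _≡_ S P → P ⊢σ drop 1 S ≈ v → P ⊢σ S ≈ v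
  σ-drop {[]}    _     = id
  σ-drop {x ∷ S} ¬S⊑P = longest-cong (λ (s , p) → there s , p) shorter
    where
    shorter : ∀ {U} → Suffix _≡_ U (x ∷ S) × Prefix _≡_ U P → Suffix _≡_ U S × Prefix _≡_ U P
    shorter (there s , p) = s , p
    shorter (here pw , p) with refl ← Pointwise-≡⇒≡ pw = contradiction p ¬S⊑P

  prefix-next : ∀ (κ : Fin (length P)) {a} → Prefix _≡_ (take (toℕ κ) P ∷ʳ a) P → a ≡ lookup P κ
  prefix-next κ p = go P κ p
    where
    go : ∀ P (κ : Fin (length P)) {a} → Prefix _≡_ (take (toℕ κ) P ∷ʳ a) P → a ≡ lookup P κ
    go (_ ∷ _) zero    (a≡ ∷ _) = a≡
    go (_ ∷ P) (suc κ) (_ ∷ p)  = go P κ p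

letterᵛ borderᵛ : Name
letterᵛ = 14
borderᵛ = 15

letter border next : Expr
letter = letterᵛ [ [] ]
border = borderᵛ [ [] ]
next   = pᵃ [ k +ᵉ # 1 ∷ [] ]

-- With row 0 cleared and `border` at 0, round 0 merely copies row 0 onto itself and needs no
-- special treatment. `extendRow` reads the next border before overwriting the entry that holds it.
clearRow copyRow extendRow preprocess : Cmd
clearRow =
  (for letterᵛ from # 0 to qᵛ [ [] ] ∸ᵉ # 1 perform
    λᵃ [ # 0 ∷ letter ∷ [] ]:= # 0) ⨾
  borderᵛ [ [] ]:= # 0
copyRow =
  for letterᵛ from # 0 to qᵛ [ [] ] ∸ᵉ # 1 perform
    λᵃ [ k ∷ letter ∷ [] ]:= λᵃ [ border ∷ letter ∷ [] ]
extendRow =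
  borderᵛ [ [] ]:= λᵃ [ k ∷ next ∷ [] ] ⨾
  λᵃ [ k ∷ next ∷ [] ]:= k +ᵉ # 1
preprocess =
  clearRow ⨾
  for kᵛ from # 0 to r ∸ᵉ # 1 perform
    (copyRow ⨾ extendRow)

costᴾ : ℕ → ℕ → ℕ
costᴾ r q =
  (6 + suc (q ∸ 1) * 6 + 2) + (6 + suc (r ∸ 1) * (2 + ((6 + suc (q ∸ 1) * 8) + (7 + 9))))

bound-preprocess : ∀ s → bound s preprocess ≡ costᴾ (s (rᵛ , [])) (s (qᵛ , []))
bound-preprocess s = refl

-- As for `costᴬ-≤`: 52 is `costᴾ 1 1`.
costᴾ-≤ : ∀ {r q} → 1 ≤ r → 1 ≤ q → costᴾ r q ≤ 52 * (r * q)
costᴾ-≤ {suc r} {suc q} _ _ = m+n≤o⇒m≤o _ (≤-reflexive (slack r q))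
  where
  slack : ∀ r q →
    (6 + (1 + q) * 6 + 2) + (6 + (1 + r) * (2 + ((6 + (1 + q) * 8) + (7 + 9)))) +
    (38 * q + 20 * r + 44 * (r * q)) ≡
    52 * ((1 + r) * (1 + q))
  slack = solve-∀

module Preprocessing {q} (P : List (Fin q)) (1≤r : 1 ≤ length P) (s₀ : Store) (pattern′ : HoldsPattern P s₀) where

  open Frame (writes preprocess)

  R : ℕ
  R = length P

  -- `P` contains a letter. Hence the loops ending at `q ∸ 1` cover exactly the `q` letters.
  1≤q : 1 ≤ q
  1≤q = ≤-trans (s≤s z≤n) (toℕ<n (lookup P (fromℕ< 1≤r)))

  q≡ : ∀ {s} → s₀ ≈ s → s (qᵛ , []) ≡ q
  q≡ h = trans (h .unchanged qᵛ [] refl) (pattern′ .alphabet-size)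

  r≡ : ∀ {s} → s₀ ≈ s → s (rᵛ , []) ≡ R
  r≡ h = trans (h .unchanged rᵛ [] refl) (pattern′ .pattern-cells .len-cell)

  row : ℕ → Fin q → Cell
  row k a = λᵃ , k ∷ toℕ a ∷ []

  Rows : ℕ → Store → Set
  Rows κ s = ∀ k → k < κ → ∀ a → P ⊢σ take k P ∷ʳ a ≈ s (row k a)

  -- Dropping the first character leaves out the whole string as a candidate, so that
  -- σ becomes the length of the longest proper border when the string is a prefix of P.
  Fallback : ℕ → Fin q → ℕ → Set
  Fallback κ a l = P ⊢σ drop 1 (take κ P ∷ʳ a) ≈ l

  -- The border is described only through the contents of its row. This also fits `κ = 0`: dropping
  -- the only letter leaves the empty string, whose σ is the 0 found in the cleared row.
  Ready : ℕ → Store → Set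
  Ready κ s = s₀ ≈ s × Rows κ s × ∀ a → Fallback κ a (s (row (s (borderᵛ , [])) a))

  write-row : ∀ {s} κ l {v} → Rows κ s → Rows κ (s [ λᵃ , κ ∷ l ∷ [] ↦ v ])
  write-row {s} κ l rows k k<κ a = update-elim (P ⊢σ take k P ∷ʳ a ≈_) s (λᵃ , κ ∷ l ∷ []) (row k a)
    (λ { refl → contradiction k<κ (<-irrefl refl) }) λ _ → rows k k<κ a

  clearRow-ready : ⟨ s₀ ≈_ ⟩ clearRow ⟨ Ready 0 ⟩
  clearRow-ready =
    consequence (λ s≈ → s≈ , λ _ ()) id
      (for-rule Cleared z≤n (cong (_∸ 1) ∘ q≡ ∘ proj₁)
        (λ (s≈ , zeros) → ≈-update letterᵛ [] refl s≈ , zeros)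
        λ l _ _ → assign-rule λ {s} ((s≈ , zeros) , l≡) →
          _ , _ , cong (λ l → 0 ∷ l ∷ []) l≡ , refl ,
          ≈-update λᵃ _ refl s≈ ,
          λ a a< → update-elim (_≡ 0) s (λᵃ , 0 ∷ l ∷ []) (row 0 a) (λ _ → refl)
            λ l≢a → zeros a (≤∧≢⇒< (≤-pred a<) λ { refl → l≢a refl })) ⨟
    assign-rule λ {s} (s≈ , zeros) → _ , _ , refl , refl ,
      ≈-update borderᵛ [] refl s≈ , (λ _ ()) ,
      λ a → subst (Fallback 0 a) (sym (zeros a (≤-trans (toℕ<n a) (≤-reflexive (sym (suc-∸1 1≤q)))))) σ-[]
    where
    Cleared : ℕ → Store → Set
    Cleared l s = s₀ ≈ s × ∀ a → toℕ a < l → s (row 0 a) ≡ 0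

  Copied : ℕ → Store → Set
  Copied κ s = s₀ ≈ s × s (kᵛ , []) ≡ κ × Rows κ s × ∀ a → Fallback κ a (s (row κ a))

  copyRow-copies : ∀ κ → ⟨ (λ s → Ready κ s × s (kᵛ , []) ≡ κ) ⟩ copyRow ⟨ Copied κ ⟩
  copyRow-copies κ = consequence
    (λ ((s≈ , rows , fall) , k≡) → s≈ , k≡ , rows , (λ _ ()) , λ a _ → fall a)
    (λ (s≈ , k≡ , rows , new , _) → s≈ , k≡ , rows ,
      λ a → new a (≤-trans (toℕ<n a) (≤-reflexive (sym (suc-∸1 1≤q)))))
    (for-rule Copying z≤n (cong (_∸ 1) ∘ q≡ ∘ proj₁)
      (λ (s≈ , rest) → ≈-update letterᵛ [] refl s≈ , rest)
      λ l _ _ → assign-rule λ {s} ((s≈ , k≡ , rows , new , old) , l≡) →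
        _ , _ , cong₂ (λ k l → k ∷ l ∷ []) k≡ l≡ ,
        cong (λ l → s (λᵃ , s (borderᵛ , []) ∷ l ∷ [])) l≡ ,
        ≈-update λᵃ _ refl s≈ , k≡ , write-row {s} κ l rows ,
        (λ a a≤l → update-elim (Fallback κ a) s (λᵃ , κ ∷ l ∷ []) (row κ a)
          (λ { refl → old a ≤-refl })
          (λ l≢a → new a (≤∧≢⇒< (≤-pred a≤l) λ { refl → l≢a refl }))) ,
        -- The row being read may be row `κ` itself, as when `κ = 0`; even then only letter `l` is
        -- overwritten, and it has already been read.
        λ a l<a → update-elim (Fallback κ a) s (λᵃ , κ ∷ l ∷ []) (row (s (borderᵛ , [])) a)
          (λ { refl → contradiction l<a (<-irrefl refl) })
          (λ _ → old a (<⇒≤ l<a)))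
    where
    Copying : ℕ → Store → Set
    Copying l s = s₀ ≈ s × s (kᵛ , []) ≡ κ × Rows κ s ×
      (∀ a → toℕ a < l → Fallback κ a (s (row κ a))) ×
      (∀ a → l ≤ toℕ a → Fallback κ a (s (row (s (borderᵛ , [])) a)))

  module _ (κ : Fin R) where

    c : Fin q
    c = lookup P κ

    next≡ : ∀ {s} → s₀ ≈ s → s (kᵛ , []) ≡ toℕ κ → s (pᵃ , s (kᵛ , []) + 1 ∷ []) ≡ toℕ c
    next≡ {s} s≈ k≡ =
      trans (cong (λ k → s (pᵃ , k ∷ [])) (trans (+-comm _ 1) (cong suc k≡)))
        (trans (s≈ .unchanged pᵃ _ refl) (pattern′ .pattern-cells .char-cells κ))

    -- If `a` is the next letter of `P`, the whole string is a prefix of `P` and wins; otherwise it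
    -- does not compete and the fallback value is the true one.
    σ-row : ∀ a {l} → Fallback (toℕ κ) a l →
            (c ≡ a → P ⊢σ take (toℕ κ) P ∷ʳ a ≈ suc (toℕ κ)) ×
            (c ≢ a → P ⊢σ take (toℕ κ) P ∷ʳ a ≈ l)
    σ-row a fall =
      (λ { refl → subst₂ (P ⊢σ_≈_) (take-suc P κ) (length-take-≤ (suc (toℕ κ)) P (toℕ<n κ))
                    (σ-prefix (take-prefix (suc (toℕ κ)) P)) }) ,
      λ c≢a → σ-drop (λ p → c≢a (sym (prefix-next κ p))) fall

    fallback-suc : ∀ {a l} → P ⊢σ drop 1 (take (suc (toℕ κ)) P) ∷ʳ a ≈ l → Fallback (suc (toℕ κ)) a l
    fallback-suc {a} {l} = subst (P ⊢σ_≈ l) (drop-∷ʳ P κ)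
      where
      drop-∷ʳ : ∀ S (u : Fin (length S)) →
                drop 1 (take (suc (toℕ u)) S) ∷ʳ a ≡ drop 1 (take (suc (toℕ u)) S ∷ʳ a)
      drop-∷ʳ (_ ∷ _) _ = refl

    -- The fallback value at the next letter is the longest proper border of `take (suc (toℕ κ)) P`.
    -- Its row is already final, and by `σ-step` that row holds the fallback values for the next
    -- round.
    advance : ⟨ Copied (toℕ κ) ⟩ extendRow ⟨ Ready (suc (toℕ κ)) ⟩
    advance =
      assign-rule {B = Bordered} (λ {s} (s≈ , k≡ , rows , fall) →
        _ , _ , refl , cong₂ (λ k l → s (λᵃ , k ∷ l ∷ [])) k≡ (next≡ s≈ k≡) ,
        (≈-update borderᵛ [] refl s≈ , k≡ , rows , fall) ,
        subst (λ S → P ⊢σ drop 1 S ≈ s (row (toℕ κ) c)) (sym (take-suc P κ)) (fall c)) ⨟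
      assign-rule λ {s} ((s≈ , k≡ , rows , fall) , σb) →
        -- The new border may be `κ` itself, for instance when all letters are equal, so row `κ` has
        -- to be completed before it is used.
        let rows′ = complete {s} rows fall in
        _ , _ , cong₂ (λ k l → k ∷ l ∷ []) k≡ (next≡ s≈ k≡) , trans (+-comm _ 1) (cong suc k≡) ,
        ≈-update λᵃ _ refl s≈ , rows′ ,
        λ a → fallback-suc
          (σ-step σb (rows′ (s (borderᵛ , [])) (s≤s (≤-trans (σ-≤-string σb) (≤-reflexive drop-length))) a))
      where
      Bordered : Store → Set
      Bordered s = Copied (toℕ κ) s × P ⊢σ drop 1 (take (suc (toℕ κ)) P) ≈ s (borderᵛ , [])
      drop-length : length (drop 1 (take (suc (toℕ κ)) P)) ≡ toℕ κ
      drop-length = trans (length-drop 1 (take (suc (toℕ κ)) P))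
        (cong (_∸ 1) (length-take-≤ (suc (toℕ κ)) P (toℕ<n κ)))
      complete : ∀ {s} → Rows (toℕ κ) s → (∀ a → Fallback (toℕ κ) a (s (row (toℕ κ) a))) →
                 Rows (suc (toℕ κ)) (s [ row (toℕ κ) c ↦ suc (toℕ κ) ])
      complete {s} rows fall k k≤κ a with m≤n⇒m<n∨m≡n (≤-pred k≤κ)
      ... | inj₁ k<κ  = write-row {s} (toℕ κ) (toℕ c) rows k k<κ a
      ... | inj₂ refl = update-elim (P ⊢σ take k P ∷ʳ a ≈_) s (row k c) (row k a)
              (λ same → proj₁ (σ-row a (fall a)) (toℕ-injective (cell-injective same)))
              (λ differ → proj₂ (σ-row a (fall a)) λ c≡a → differ (cong (row k) c≡a))
        where
        cell-injective : ∀ {x l l′} → _≡_ {A = Cell} (λᵃ , x ∷ l ∷ []) (λᵃ , x ∷ l′ ∷ []) → l ≡ l′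
        cell-injective refl = refl

  preprocess-fills : ⟨ s₀ ≈_ ⟩ preprocess ⟨ HoldsTable P ⟩
  preprocess-fills = clearRow-ready ⨟ consequence id
    (λ (_ , rows , _) k k<R → rows k (≤-trans k<R (≤-reflexive (sym (suc-∸1 1≤r)))))
    (for-rule Ready z≤n (cong (_∸ 1) ∘ r≡ ∘ proj₁)
      (λ (s≈ , rest) → ≈-update kᵛ [] refl s≈ , rest)
      λ κ _ κ≤ → round (fromℕ< (≤-∸1 1≤r κ≤)) (toℕ-fromℕ< (≤-∸1 1≤r κ≤)))
    where
    round : ∀ {κ} (u : Fin R) → toℕ u ≡ κ →
            ⟨ (λ s → Ready κ s × s (kᵛ , []) ≡ κ) ⟩ copyRow ⨾ extendRow ⟨ Ready (suc κ) ⟩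
    round u refl = copyRow-copies (toℕ u) ⨟ advance u

  holds-string : ∀ {s} array len {S : List (Fin q)} →
                 writes preprocess array ≡ false → writes preprocess len ≡ false →
                 s₀ ≈ s → HoldsString array len S s₀ → HoldsString array len S s
  holds-string array len wa wl s≈ h .len-cell     = trans (s≈ .unchanged len [] wl) (h .len-cell)
  holds-string array len wa wl s≈ h .char-cells u = trans (s≈ .unchanged array _ wa) (h .char-cells u)

  holds-pattern : ∀ {s} → s₀ ≈ s → HoldsPattern P s
  holds-pattern s≈ .alphabet-size = q≡ s≈
  holds-pattern s≈ .pattern-cells = holds-string pᵃ rᵛ refl refl s≈ (pattern′ .pattern-cells)

  holds-texts : ∀ {s X Y} → s₀ ≈ s → HoldsTexts X Y s₀ → HoldsTexts X Y s
  holds-texts s≈ texts .X-cells = holds-string xᵃ nᵛ refl refl s≈ (texts .X-cells)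
  holds-texts s≈ texts .Y-cells = holds-string yᵃ mᵛ refl refl s≈ (texts .Y-cells)

  preprocess-agrees : s₀ ≈ final (exec preprocess s₀)
  preprocess-agrees = exec-frame preprocess refl s₀

  preprocess-time : time (exec preprocess s₀) ≤ 52 * (R * q)
  preprocess-time =
    ≤-trans (exec-time preprocess refl s₀)
      (≤-trans (≤-reflexive (trans (bound-preprocess s₀) (cong₂ costᴾ (r≡ {s₀} ≈-refl) (q≡ {s₀} ≈-refl))))
        (costᴾ-≤ 1≤r 1≤q))

theorem3 : (∃[ C ] ∀ {q : ℕ} (X Y P : List (Fin q)) →
    1 ≤ length X → 1 ≤ length Y → 1 ≤ length P →
    ∀ (s : Store) → HoldsTexts X Y s → HoldsPattern P s → HoldsTable P s →
    let run = exec algorithmA s in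
    STR-EC-LCS X Y P (output run)
    × time run ≤ C * (length X * length Y * length P)
    × space run ≤ C * (length X * length Y * length P))
    ×
    (∃[ preprocess ] ∃[ C ] ∀ {q : ℕ} (P : List (Fin q)) →
    1 ≤ length P →
    ∀ (s : Store) → HoldsPattern P s →
    let run = exec preprocess s in
    HoldsTable P (final run)
    × HoldsPattern P (final run)
    × (∀ (X Y : List (Fin q)) → HoldsTexts X Y s → HoldsTexts X Y (final run))
    × time run ≤ C * (length P * q))
theorem3 =
  (196 , λ X Y P 1≤n 1≤m 1≤r s texts pattern′ table →
    let open Correctness X Y P 1≤r s texts pattern′ table
        open Frame (writes algorithmA)
    in  algorithmA-correct .run ≈-refl ,
        algorithmA-time 1≤n 1≤m ,
        ≤-trans (space≤time algorithmA s) (algorithmA-time 1≤n 1≤m)) ,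
  (preprocess , 52 , λ P 1≤r s pattern′ →
    let open Preprocessing P 1≤r s pattern′
        open Frame (writes preprocess)
    in  preprocess-fills .run ≈-refl ,
        holds-pattern preprocess-agrees ,
        (λ X Y → holds-texts preprocess-agrees) ,
        preprocess-time)
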